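{- There is an algorithm that decides the problem PERFECT MATCHING CUT on every input graph with $n$ vertices in time $O^*(1.2721^n)$.
   Context: Graphs are finite, simple and undirected. A cut of a graph $G=(V,E)$ is a partition $V=X\cup Y$ of the vertex set into disjoint non-empty sets $X,Y$; its edge cut $E(X,Y)$ is the set of all edges with one endvertex in $X$ and the other in $Y$. A perfect matching cut of $G$ is an edge cut $E(X,Y)$ that is a perfect matching of $G$; equivalently, every vertex of $X$ has exactly one neighbor in $Y$ and every vertex of $Y$ has exactly one neighbor in $X$. PERFECT MATCHING CUT is the problem of deciding whether a given graph has a perfect matching cut. The notation $O^*$ suppresses factors polynomial in the input size. -}

module Defs where

open import Data.Bool using (Bool; true; false)
open import Data.Fin using (Fin)
open import Data.Fin.Subset using (Subset; _∈_; _∪_; _∩_; ⊤; ⊥; Nonempty)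
open import Data.List using (List; []; _∷_; map; allFin)
open import Data.Nat using (ℕ; suc; _+_; _*_; _^_; _≤_; NonZero)
open import Data.Product using (_×_; _,_; ∃-syntax)
open import Data.Sum using (_⊎_)
open import Data.Vec using (Vec; []; _∷_; lookup)
open import Relation.Binary.Core using (Rel)
open import Relation.Binary.Definitions using (Symmetric)
open import Relation.Binary.PropositionalEquality using (_≡_; refl)
open import Relation.Nullary using (Reflects)
open import Level using (0ℓ)

record Graph (n : ℕ) : Set where
  field
    adj        : Fin n → Fin n → Bool
    adj-sym    : ∀ u v → adj u v ≡ adj v u
    adj-irrefl : ∀ v → adj v v ≡ false

  Adj : Rel (Fin n) 0ℓ
  Adj u v = adj u v ≡ true

-- A set of edges is represented by a symmetric subrelation of adjacency:
-- the edge uv belongs to M when M u v (equivalently M v u) holds.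
record IsPerfectMatching {n} (G : Graph n) (M : Rel (Fin n) 0ℓ) : Set where
  field
    symmetric : Symmetric M
    edges     : ∀ {u v} → M u v → Graph.Adj G u v
    matching  : ∀ {u v w} → M u v → M u w → v ≡ w
    perfect   : ∀ u → ∃[ v ] M u v

record IsCut {n} (X Y : Subset n) : Set where
  field
    covers     : X ∪ Y ≡ ⊤
    disjoint   : X ∩ Y ≡ ⊥
    X-nonempty : Nonempty X
    Y-nonempty : Nonempty Y

EdgeCut : ∀ {n} → Graph n → Subset n → Subset n → Rel (Fin n) 0ℓ
EdgeCut G X Y u v = Graph.Adj G u v × ((u ∈ X × v ∈ Y) ⊎ (u ∈ Y × v ∈ X))

HasPerfectMatchingCut : ∀ {n} → Graph n → Set
HasPerfectMatchingCut {n} G =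
  ∃[ X ] ∃[ Y ] (IsCut {n} X Y × IsPerfectMatching G (EdgeCut G X Y))

-- Model of computation: first-order recursive programs over binary trees
-- (in the style of Jones's languages WHILE and F).  The only primitives are
-- building a pair, inspecting a pair, and calling a function of the program.
-- The number of functions, their arities and the sizes of their bodies are
-- fixed with the program, so with trees held as pointers each unit of cost
-- is a bounded number of operations of a random-access machine.

data Tree : Set where
  nil  : Tree
  cons : Tree → Tree → Tree

size : Tree → ℕ
size nil        = 1
size (cons s t) = suc (size s + size t)

-- Exp ar k: expressions with k variables (de Bruijn indices) that may call
-- m functions of arities ar.
data Exp {m : ℕ} (ar : Fin m → ℕ) (k : ℕ) : Set where
  var  : Fin k → Exp ar k
  nil  : Exp ar k
  cons : Exp ar k → Exp ar k → Exp ar k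
  bind : Exp ar k → Exp ar (suc k) → Exp ar k
  -- In the second branch, variables 0 and 1 are the left and right subtrees.
  case : Exp ar k → Exp ar k → Exp ar (2 + k) → Exp ar k
  call : (f : Fin m) → Vec (Exp ar k) (ar f) → Exp ar k

-- main has the input as its only variable.
record Program : Set where
  field
    {functions} : ℕ
    arity       : Fin functions → ℕ
    body        : (f : Fin functions) → Exp arity (arity f)
    main        : Exp arity 1

-- Call-by-value evaluation.  ρ ⊢ e ⇓ v ∣ t : in environment ρ, the expression
-- e evaluates to v in t steps, where each use of a rule for ⇓ is one step.
module Evaluation (P : Program) where
  open Program P

  infix 4 _⊢_⇓_∣_ _⊢_⇓*_∣_

  mutual
    data _⊢_⇓_∣_ {k} (ρ : Vec Tree k) : Exp arity k → Tree → ℕ → Set where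
      var : ∀ i → ρ ⊢ var i ⇓ lookup ρ i ∣ 1
      nil : ρ ⊢ nil ⇓ nil ∣ 1
      cons : ∀ {e₁ e₂ v₁ v₂ t₁ t₂} →
        ρ ⊢ e₁ ⇓ v₁ ∣ t₁ → ρ ⊢ e₂ ⇓ v₂ ∣ t₂ →
        ρ ⊢ cons e₁ e₂ ⇓ cons v₁ v₂ ∣ suc (t₁ + t₂)
      bind : ∀ {e₁ e₂ v₁ v₂ t₁ t₂} →
        ρ ⊢ e₁ ⇓ v₁ ∣ t₁ → v₁ ∷ ρ ⊢ e₂ ⇓ v₂ ∣ t₂ →
        ρ ⊢ bind e₁ e₂ ⇓ v₂ ∣ suc (t₁ + t₂)
      case-nil : ∀ {e e₁ e₂ v t t₁} →
        ρ ⊢ e ⇓ nil ∣ t → ρ ⊢ e₁ ⇓ v ∣ t₁ →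
        ρ ⊢ case e e₁ e₂ ⇓ v ∣ suc (t + t₁)
      case-cons : ∀ {e e₁ e₂ l r v t t₂} →
        ρ ⊢ e ⇓ cons l r ∣ t → l ∷ r ∷ ρ ⊢ e₂ ⇓ v ∣ t₂ →
        ρ ⊢ case e e₁ e₂ ⇓ v ∣ suc (t + t₂)
      call : ∀ {f es vs v t₁ t₂} →
        ρ ⊢ es ⇓* vs ∣ t₁ → vs ⊢ body f ⇓ v ∣ t₂ →
        ρ ⊢ call f es ⇓ v ∣ suc (t₁ + t₂)

    data _⊢_⇓*_∣_ {k} (ρ : Vec Tree k) :
           ∀ {j} → Vec (Exp arity k) j → Vec Tree j → ℕ → Set where
      []  : ρ ⊢ [] ⇓* [] ∣ 0
      _∷_ : ∀ {j e v t₁ t₂} {es : Vec (Exp arity k) j} {vs} →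
        ρ ⊢ e ⇓ v ∣ t₁ → ρ ⊢ es ⇓* vs ∣ t₂ →
        ρ ⊢ e ∷ es ⇓* v ∷ vs ∣ t₁ + t₂

  mutual
    ⇓-deterministic : ∀ {k} {ρ : Vec Tree k} {e v w s t} →
      ρ ⊢ e ⇓ v ∣ s → ρ ⊢ e ⇓ w ∣ t → v ≡ w × s ≡ t
    ⇓-deterministic (var i) (var .i) = refl , refl
    ⇓-deterministic nil nil = refl , refl
    ⇓-deterministic (cons p q) (cons p′ q′)
      with refl , refl ← ⇓-deterministic p p′
         | refl , refl ← ⇓-deterministic q q′ = refl , refl
    ⇓-deterministic (bind p q) (bind p′ q′)
      with refl , refl ← ⇓-deterministic p p′
      with refl , refl ← ⇓-deterministic q q′ = refl , refl
    ⇓-deterministic (case-nil p q) (case-nil p′ q′)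
      with refl , refl ← ⇓-deterministic p p′
         | refl , refl ← ⇓-deterministic q q′ = refl , refl
    ⇓-deterministic (case-nil p q) (case-cons p′ q′)
      with () , _ ← ⇓-deterministic p p′
    ⇓-deterministic (case-cons p q) (case-nil p′ q′)
      with () , _ ← ⇓-deterministic p p′
    ⇓-deterministic (case-cons p q) (case-cons p′ q′)
      with refl , refl ← ⇓-deterministic p p′
      with refl , refl ← ⇓-deterministic q q′ = refl , refl
    ⇓-deterministic (call p q) (call p′ q′)
      with refl , refl ← ⇓*-deterministic p p′
      with refl , refl ← ⇓-deterministic q q′ = refl , refl

    ⇓*-deterministic : ∀ {k j} {ρ : Vec Tree k} {es : Vec (Exp arity k) j}
      {vs ws s t} → ρ ⊢ es ⇓* vs ∣ s → ρ ⊢ es ⇓* ws ∣ t → vs ≡ ws × s ≡ t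
    ⇓*-deterministic [] [] = refl , refl
    ⇓*-deterministic (p ∷ q) (p′ ∷ q′)
      with refl , refl ← ⇓-deterministic p p′
         | refl , refl ← ⇓*-deterministic q q′ = refl , refl

_on_Returns_In_Steps : Program → Tree → Tree → ℕ → Set
P on x Returns v In t Steps = x ∷ [] ⊢ Program.main P ⇓ v ∣ t
  where open Evaluation P

encodeBool : Bool → Tree
encodeBool false = nil
encodeBool true  = cons nil nil

encodeList : List Tree → Tree
encodeList []       = nil
encodeList (x ∷ xs) = cons x (encodeList xs)

-- The adjacency matrix, as the list of its rows.
encode : ∀ {n} → Graph n → Tree
encode {n} G =
  encodeList (map (λ u → encodeList (map (λ v → encodeBool (adj u v)) (allFin n)))
                  (allFin n))
  where open Graph G

GraphProblem : Set₁
GraphProblem = ∀ {n} → Graph n → Set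

-- A decides Π in time O*((p/q)ⁿ), that is, in at most c · sᵏ · (p/q)ⁿ steps
-- for some constants c and k, where n is the number of vertices and s the size
-- of the input.  The inequality is multiplied by qⁿ.
_Decides_InTimeO*⟨_/_⟩ⁿ :
  Program → GraphProblem → ℕ → (q : ℕ) .{{_ : NonZero q}} → Set
A Decides Π InTimeO*⟨ p / q ⟩ⁿ =
  ∃[ c ] ∃[ k ] ∀ {n} (G : Graph n) →
    ∃[ b ] ∃[ t ]
      (A on encode G Returns encodeBool b In t Steps)
      × Reflects (Π G) b
      × t * q ^ n ≤ c * size (encode G) ^ k * p ^ n

{-# OPTIONS --safe #-}
-- Colour the two sides of the cut: a colouring is a solution when every vertex
-- has exactly one neighbour of the other colour, its partner.  Partial colourings
-- are first extended by forced colours.  When nothing is forced, a coloured vertex v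
-- with an uncoloured neighbour has at least two of them, they are pairwise
-- non-adjacent, and each of them either sees both colours or has two uncoloured
-- neighbours itself.  The algorithm then branches on the partner of v, or of a
-- neighbour that sees both colours, and the numbers of newly coloured vertices are
-- at least (2,4), (3,3), or d + 2 in each of d branches.  The worst case is (2,4),
-- with x⁴ = x² + 1 at x = √((1+√5)/2) < 1.2721.  If no coloured vertex has an
-- uncoloured neighbour, exchanging the colours of the uncoloured vertices preserves
-- solutions, so one of them is coloured arbitrarily.
--
-- All tests and recolourings are first-order definable.  The program interprets
-- formulas stored as trees, in polynomial time for each formula, and the time for a
-- colouring with u uncoloured vertices is at most (u + 1) · poly(n) · 1.2721ᵘ.
module Submission where

open import Data.Bool using (Bool; true; false; not; if_then_else_; T)
import Data.Bool.Properties as Bool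
open import Data.Fin as Fin using (Fin; zero; suc; toℕ)
open import Data.Fin.Patterns
import Data.Fin.Properties as Fin
open import Data.Fin.Subset using (Subset) renaming (_∈_ to _∈ˢ_)
open import Data.Fin.Subset.Properties
  using (_∈?_; ∉⊥; ∈⊤; x∈p∩q⁺; x∈p∩q⁻; x∈p∪q⁺; x∈p∪q⁻; ⊆-antisym; Empty-unique)
open import Data.List using (List; []; _∷_; _++_; map; length; filter; allFin; tabulate)
open import Data.List.Membership.Propositional using (_∈_)
open import Data.List.Membership.Propositional.Properties
  using (∈-∃++; ∈-++⁺ˡ; ∈-++⁺ʳ; ∈-++⁻; ∈-filter⁺; ∈-filter⁻; ∈-allFin)
open import Data.List.Properties
  using (map-++; length-++; length-map; length-tabulate; map-cong; map-tabulate;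
         tabulate-cong; filter-accept; filter-all; filter-reject)
open import Data.List.Relation.Binary.Subset.Propositional using (_⊆_)
open import Data.List.Relation.Unary.All as All using ([]; _∷_)
open import Data.List.Relation.Unary.AllPairs using ([]; _∷_)
open import Data.List.Relation.Unary.Any using (here; there)
open import Data.List.Relation.Unary.Unique.Propositional using (Unique)
import Data.List.Relation.Unary.Unique.Propositional.Properties as Unique
open import Data.Maybe using (Maybe; just; nothing; _<∣>_)
import Data.Maybe.Properties as Maybe
open import Data.Nat
  using (ℕ; NonZero; nonZero; zero; suc; _+_; _*_; _^_; _∸_; _≤_; _<_; _≤ᵇ_; z≤n; s≤s)
open import Data.Nat.Induction using (<-wellFounded)
open import Data.Nat.ListAction using (sum)
open import Data.Nat.ListAction.Properties using (sum-++)
import Data.Nat.Properties as ℕ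
open import Data.Nat.Tactic.RingSolver using (solve-∀)
open import Data.Product using (∃; ∃-syntax; ∃₂; _×_; _,_; proj₁; proj₂)
open import Data.Sum using (_⊎_; inj₁; inj₂; [_,_]′)
open import Data.Vec as Vec using (Vec; []; _∷_; lookup)
open import Data.Vec.Functional using (Vector) renaming ([] to ⟨⟩; _∷_ to _▸_)
open import Data.Vec.Properties using (lookup⇒[]=; []=⇒lookup; lookup∘tabulate)
open import Function using (_∘_; id; case_of_)
open import Induction.WellFounded using (Acc; acc)
open import Relation.Binary.PropositionalEquality
  using (_≡_; _≢_; refl; sym; trans; cong; subst)
open import Relation.Nullary
  using (¬_; Dec; yes; no; does; Reflects; ofʸ; ofⁿ; contradiction; ¬?; _×-dec_; _⊎-dec_; _→-dec_)
open import Relation.Nullary.Decidable using (True; toWitness; decidable-stable; dec-true; dec-false)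
open import Defs

-- Time is the step count of a fixed tree program, so every operation needs a derivation with a
-- bound. This is why the branching rules are data: one verified interpreter serves all of them, and
-- what remains for each rule is combinatorial (`Valid`): no branching loses solvability, the number
-- of uncoloured vertices falls, and the weights of the branches sum to at most `P ^ u`. Real
-- exponents are avoided by keeping the rate as a fraction `P / Q` and multiplying out. The vector
-- to be avoided is (2,2), of rate √2, at a coloured vertex with exactly two uncoloured neighbours.
-- A neighbour that does not see both colours brings two further vertices, by `degree-two` and
-- `triangle`. If both neighbours see both colours, a third new vertex can be missing only when they
-- are twins, and `twins` removes that case. The order of the rules matters: each rule after the two
-- forcing ones is justified by the failure of earlier rules.

-- Cutting one occurrence of `x` out of `ys` leaves a list that still contains the rest of `xs`,
-- which avoids `x`. Sums over branches are compared in this way with sums over an explicit list of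
-- vertices.
sum-mono-⊆ : ∀ {A : Set} (f : A → ℕ) {xs ys : List A} →
  Unique xs → xs ⊆ ys → sum (map f xs) ≤ sum (map f ys)
sum-mono-⊆ f {[]} _ _ = z≤n
sum-mono-⊆ f {x ∷ xs} (x∉xs ∷ xs!) xs⊆ys
  with as , bs , refl ← ∈-∃++ (xs⊆ys (here refl)) = begin
    f x + sum (map f xs)                      ≤⟨ ℕ.+-monoʳ-≤ (f x) (sum-mono-⊆ f xs! xs⊆as++bs) ⟩
    f x + sum (map f (as ++ bs))              ≡⟨ cong (f x +_) (sum-map-++ as bs) ⟩
    f x + (sum (map f as) + sum (map f bs))   ≡⟨ ℕ.+-assoc (f x) _ _ ⟨
    f x + sum (map f as) + sum (map f bs)     ≡⟨ cong (_+ sum (map f bs)) (ℕ.+-comm (f x) _) ⟩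
    sum (map f as) + f x + sum (map f bs)     ≡⟨ ℕ.+-assoc (sum (map f as)) _ _ ⟩
    sum (map f as) + (f x + sum (map f bs))   ≡⟨ sum-map-++ as (x ∷ bs) ⟨
    sum (map f (as ++ x ∷ bs))                ∎
  where
  open ℕ.≤-Reasoning
  sum-map-++ : ∀ as bs → sum (map f (as ++ bs)) ≡ sum (map f as) + sum (map f bs)
  sum-map-++ as bs = trans (cong sum (map-++ f as bs)) (sum-++ (map f as) (map f bs))
  xs⊆as++bs : xs ⊆ as ++ bs
  xs⊆as++bs y∈xs with ∈-++⁻ as (xs⊆ys (there y∈xs))
  ... | inj₁ y∈as         = ∈-++⁺ˡ y∈as
  ... | inj₂ (here refl)  = contradiction refl (All.lookup x∉xs y∈xs)
  ... | inj₂ (there y∈bs) = ∈-++⁺ʳ as y∈bs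

length-mono-⊆ : ∀ {A : Set} {xs ys : List A} → Unique xs → xs ⊆ ys → length xs ≤ length ys
length-mono-⊆ {A} {xs} {ys} xs! xs⊆ys =
  ℕ.≤-trans (ℕ.≤-reflexive (len xs))
    (ℕ.≤-trans (sum-mono-⊆ (λ _ → 1) xs! xs⊆ys) (ℕ.≤-reflexive (sym (len ys))))
  where
  len : (zs : List A) → length zs ≡ sum (map (λ _ → 1) zs)
  len []       = refl
  len (_ ∷ zs) = cong suc (len zs)

-- Formulas and partial colourings

infixr 7 _∧_
infixr 6 _∨_
infixr 5 _⇒_

data Formula (k : ℕ) : Set where
  edge equal  : Fin k → Fin k → Formula k
  col         : Maybe Bool → Fin k → Formula k
  neg         : Formula k → Formula k
  _∧_ _∨_ _⇒_ : Formula k → Formula k → Formula k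
  ex all      : Formula (suc k) → Formula k

-- If the guard holds of p, solve branches over the w with branch (w, p), and then
-- gives colour b to the uncoloured u with to b (u, w, p).  Variable 0 comes first.
record Rule : Set where
  field
    guard  : Formula 1
    branch : Formula 2
    to     : Bool → Formula 3

Coloring : ℕ → Set
Coloring n = Fin n → Maybe Bool

module Semantics {n} (G : Graph n) where
  open Graph G

  module _ (c : Coloring n) where

    Sat : ∀ {k} → Formula k → Vector (Fin n) k → Set
    Sat (edge i j)  ρ = Adj (ρ i) (ρ j)
    Sat (equal i j) ρ = ρ i ≡ ρ j
    Sat (col m i)   ρ = c (ρ i) ≡ m
    Sat (neg φ)     ρ = ¬ Sat φ ρ
    Sat (φ ∧ ψ)     ρ = Sat φ ρ × Sat ψ ρ
    Sat (φ ∨ ψ)     ρ = Sat φ ρ ⊎ Sat ψ ρ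
    Sat (φ ⇒ ψ)     ρ = Sat φ ρ → Sat ψ ρ
    Sat (ex φ)      ρ = ∃[ v ] Sat φ (v ▸ ρ)
    Sat (all φ)     ρ = ∀ v → Sat φ (v ▸ ρ)

    sat? : ∀ {k} (φ : Formula k) ρ → Dec (Sat φ ρ)
    sat? (edge i j)  ρ = adj (ρ i) (ρ j) Bool.≟ true
    sat? (equal i j) ρ = ρ i Fin.≟ ρ j
    sat? (col m i)   ρ = Maybe.≡-dec Bool._≟_ (c (ρ i)) m
    sat? (neg φ)     ρ = ¬? (sat? φ ρ)
    sat? (φ ∧ ψ)     ρ = sat? φ ρ ×-dec sat? ψ ρ
    sat? (φ ∨ ψ)     ρ = sat? φ ρ ⊎-dec sat? ψ ρ
    sat? (φ ⇒ ψ)     ρ = sat? φ ρ →-dec sat? ψ ρ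
    sat? (ex φ)      ρ = Fin.any? (λ v → sat? φ (v ▸ ρ))
    sat? (all φ)     ρ = Fin.all? (λ v → sat? φ (v ▸ ρ))

  -- Non-emptiness of the two classes is not demanded: the partner of any vertex lies in the other
  -- class, so it is automatic once there is a vertex. The empty graph is treated separately.
  record IsSolution (s : Fin n → Bool) : Set where
    field
      partner : Fin n → Fin n
      adjacent : ∀ u → Adj u (partner u)
      opposite : ∀ u → s (partner u) ≡ not (s u)
      unique   : ∀ {u w} → Adj u w → s w ≡ not (s u) → w ≡ partner u

    others : ∀ {u x w} → Adj u x → s x ≡ not (s u) → Adj u w → w ≢ x → s w ≡ s u
    others {u} {x} {w} ux sx uw w≢x with s w Bool.≟ s u
    ... | yes sw≡su = sw≡su
    ... | no sw≢su  = contradiction (trans (unique uw (Bool.¬-not sw≢su)) (sym (unique ux sx))) w≢x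

    opposite-≢ : ∀ {u} → s (partner u) ≢ s u
    opposite-≢ {u} eq = Bool.not-¬ eq (opposite u)

    opposite-unique : ∀ {u x w} → Adj u x → s x ≡ not (s u) → Adj u w → s w ≡ not (s u) → w ≡ x
    opposite-unique ux sx uw sw = trans (unique uw sw) (sym (unique ux sx))

  Extends : Coloring n → (Fin n → Bool) → Set
  Extends c s = ∀ {u b} → c u ≡ just b → s u ≡ b

  Solvable : Coloring n → Set
  Solvable c = ∃[ s ] (IsSolution s × Extends c s)

  ~-sym : ∀ {u v} → Adj u v → Adj v u
  ~-sym {u} {v} uv = trans (adj-sym v u) uv

  ~-irrefl : ∀ {v} → ¬ Adj v v
  ~-irrefl {v} vv = case trans (sym (adj-irrefl v)) vv of λ ()

  ~⇒≢ : ∀ {u v} → Adj u v → u ≢ v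
  ~⇒≢ uv refl = ~-irrefl uv

  -- All tests refer to the old colouring, so the vertices are recoloured simultaneously. If both
  -- tests succeed at an uncoloured vertex, preferring `true` does no harm: no `s` then meets the
  -- hypothesis of `recolor-extends`, and any solution found afterwards still extends `c`.
  recolor-at : Coloring n → Rule → (p w u : Fin n) → Maybe Bool
  recolor-at c r p w u =
    if does (sat? c (to true) ρ) then just true else
    if does (sat? c (to false) ρ) then just false else nothing
    where
    open Rule r
    ρ = u ▸ w ▸ p ▸ ⟨⟩

  recolor : Coloring n → Rule → (p w : Fin n) → Coloring n
  recolor c r p w u = c u <∣> recolor-at c r p w u

  uncolored? : (c : Coloring n) (v : Fin n) → Dec (c v ≡ nothing)
  uncolored? c v = Maybe.≡-dec Bool._≟_ (c v) nothing

  uncolored : Coloring n → List (Fin n)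
  uncolored c = filter (uncolored? c) (allFin n)

  #unc : Coloring n → ℕ
  #unc c = length (uncolored c)

  branches : Coloring n → Rule → Fin n → List (Fin n)
  branches c r p = filter (λ w → sat? c (Rule.branch r) (w ▸ p ▸ ⟨⟩)) (allFin n)

  module _ {c : Coloring n} {r : Rule} {p w : Fin n} where
    open Rule r

    recolor-colored : ∀ {u b} → c u ≡ just b → recolor c r p w u ≡ just b
    recolor-colored {u} eq with just _ ← c u = eq

    recolor-keeps : ∀ {u} → recolor c r p w u ≡ nothing → c u ≡ nothing
    recolor-keeps {u} eq with nothing ← c u = refl

    recolor-reaches : ∀ {u} b → Sat c (to b) (u ▸ w ▸ p ▸ ⟨⟩) → recolor c r p w u ≢ nothing
    recolor-reaches {u} b h with c u
    recolor-reaches {u} b h | nothing with sat? c (to true) (u ▸ w ▸ p ▸ ⟨⟩)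
    recolor-reaches {u} true h  | nothing | no ¬h = contradiction h ¬h
    recolor-reaches {u} false h | nothing | no _ with sat? c (to false) (u ▸ w ▸ p ▸ ⟨⟩)
    recolor-reaches {u} false h | nothing | no _ | no ¬h = contradiction h ¬h

    recolor-extends : ∀ {s} → Extends c s →
      (∀ {u} b → c u ≡ nothing → Sat c (to b) (u ▸ w ▸ p ▸ ⟨⟩) → s u ≡ b) →
      Extends (recolor c r p w) s
    recolor-extends ext h {u} eq with c u in cu
    recolor-extends ext h {u} refl | just b  = ext cu
    recolor-extends ext h {u} eq   | nothing with sat? c (to true) (u ▸ w ▸ p ▸ ⟨⟩)
    recolor-extends ext h {u} refl | nothing | yes t = h true cu t
    recolor-extends ext h {u} eq   | nothing | no _ with sat? c (to false) (u ▸ w ▸ p ▸ ⟨⟩)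
    recolor-extends ext h {u} refl | nothing | no _ | yes f = h false cu f

    recolor-unextends : ∀ {s} → Extends (recolor c r p w) s → Extends c s
    recolor-unextends ext cu = ext (recolor-colored cu)

    -- The vertices in `xs` and those left uncoloured are disjoint, and all of them were uncoloured
    -- before.
    #unc-drop : ∀ {xs} → Unique xs →
      (∀ {u} → u ∈ xs → c u ≡ nothing × ∃[ b ] Sat c (to b) (u ▸ w ▸ p ▸ ⟨⟩)) →
      length xs + #unc (recolor c r p w) ≤ #unc c
    #unc-drop {xs} xs! h = begin
      length xs + length ys ≡⟨ length-++ xs ⟨
      length (xs ++ ys)     ≤⟨ length-mono-⊆ (Unique.++⁺ xs! ys! disj) sub ⟩
      #unc c                ∎
      where
      open ℕ.≤-Reasoning
      ys = uncolored (recolor c r p w)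
      ys! = Unique.filter⁺ (uncolored? (recolor c r p w)) (Unique.allFin⁺ n)
      un : ∀ {u} → u ∈ ys → recolor c r p w u ≡ nothing
      un u∈ys = proj₂ (∈-filter⁻ (uncolored? (recolor c r p w)) {xs = allFin n} u∈ys)
      disj : ∀ {u} → ¬ (u ∈ xs × u ∈ ys)
      disj (u∈xs , u∈ys) with _ , b , t ← h u∈xs = recolor-reaches b t (un u∈ys)
      sub : xs ++ ys ⊆ uncolored c
      sub u∈ with ∈-++⁻ xs u∈
      ... | inj₁ u∈xs = ∈-filter⁺ (uncolored? c) (∈-allFin _) (proj₁ (h u∈xs))
      ... | inj₂ u∈ys = ∈-filter⁺ (uncolored? c) (∈-allFin _) (recolor-keeps (un u∈ys))

-- Branching rules

-- Reasons for giving `p` the colour `b`. `matched`: a neighbour of colour `b` already has its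
-- partner. `two-alike`: with the other colour `p` would have two partners. `last`: a neighbour of
-- the other colour has no other candidate for a partner. `degree-two`: the two neighbours of a
-- vertex of degree two have different colours, and a leaf differs from its only neighbour.
-- `triangle`: triangles are monochromatic.
forcing : Bool → Formula 1
forcing b = matched ∨ two-alike ∨ last ∨ degree-two ∨ triangle ∨ twins
  where
  matched two-alike last degree-two triangle twins : Formula 1
  matched = ex (edge 0F 1F ∧ col (just b) 0F ∧ ex (edge 1F 0F ∧ col (just (not b)) 0F))
  two-alike = ex (ex (edge 0F 2F ∧ edge 1F 2F ∧ neg (equal 0F 1F) ∧
                      col (just b) 0F ∧ col (just b) 1F))
  last = ex (edge 0F 1F ∧ col (just (not b)) 0F ∧
             all (edge 1F 0F ⇒ neg (equal 0F 2F) ⇒ col (just (not b)) 0F))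
  degree-two = ex (ex (edge 0F 1F ∧ (edge 0F 2F ∨ equal 0F 2F) ∧ col (just (not b)) 1F ∧
                       all (edge 1F 0F ⇒ equal 0F 2F ∨ equal 0F 3F)))
  triangle = ex (ex (edge 1F 2F ∧ col (just b) 1F ∧ edge 0F 2F ∧ edge 0F 1F))
  -- Exchanging twins is an automorphism, so either of them may be the partner.
  twins = ex (ex (edge 1F 2F ∧ edge 1F 0F ∧ neg (equal 0F 2F) ∧
                  col (just (not b)) 1F ∧ col nothing 0F ∧
                  all (edge 2F 0F ⇒ equal 0F 3F ∨ equal 0F 1F ∨ col (just (not b)) 0F) ∧
                  all ((edge 3F 0F ⇒ edge 1F 0F) ∧ (edge 1F 0F ⇒ edge 3F 0F))))

-- Colouring one vertex is a branching rule with the single branch `w = p`. The formulas have no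
-- constants, so `neg (equal 0F 0F)` serves as falsity.
paint : Bool → Formula 1 → Rule
paint b φ = record
  { guard  = col nothing 0F ∧ φ
  ; branch = equal 0F 1F
  ; to     = λ where
      true  → if b then equal 0F 2F else neg (equal 0F 0F)
      false → if b then neg (equal 0F 0F) else equal 0F 2F
  }

-- mate b v x u: if v is coloured and x is its partner, then u has colour b.
-- The existential formulas concern a neighbour y ≠ x of v that is adjacent to
-- a vertex t of the colour opposite to v, so that t is the partner of y.
mate : ∀ {k} → Bool → (v x u : Fin k) → Formula k
mate b v x u = (col (just b) v ∧ same) ∨ (col (just (not b)) v ∧ opposite)
  where
  same = (edge v u ∧ neg (equal u x)) ∨
    ex (edge (suc v) 0F ∧ neg (equal 0F (suc x)) ∧ col nothing 0F ∧ edge 0F (suc u) ∧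
        ex (edge 1F 0F ∧ col (just (not b)) 0F))
  opposite = equal u x ∨ edge x u ∨
    ex (ex (edge (suc (suc v)) 1F ∧ neg (equal 1F (suc (suc x))) ∧ col nothing 1F ∧
            edge 1F 0F ∧ col (just b) 0F ∧
            edge 0F (suc (suc u)) ∧ neg (equal (suc (suc u)) 1F)))

-- Numbers of newly coloured vertices: (2,4) or (3,3) for at-two, (3,3) for at-mixed,
-- and d + 2 in each of the d branches for at-many.
at-two at-mixed at-many fresh : Rule
at-two = record
  { guard  = neg (col nothing 0F) ∧
      ex (ex (edge 2F 1F ∧ edge 2F 0F ∧ neg (equal 1F 0F) ∧ col nothing 1F ∧ col nothing 0F ∧
              all (edge 3F 0F ⇒ col nothing 0F ⇒ equal 0F 2F ∨ equal 0F 1F)))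
  ; branch = edge 1F 0F ∧ col nothing 0F
  ; to     = λ b → mate b 2F 1F 0F
  }
at-mixed = record
  { guard  = col nothing 0F ∧ ex (edge 1F 0F ∧ col (just true) 0F) ∧
             ex (edge 1F 0F ∧ col (just false) 0F)
  ; branch = edge 1F 0F ∧ neg (col nothing 0F)
  ; to     = λ b → mate b 1F 2F 0F
  }
at-many = record
  { guard  = neg (col nothing 0F) ∧ ex (edge 1F 0F ∧ col nothing 0F)
  ; branch = edge 1F 0F ∧ col nothing 0F
  ; to     = λ b → mate b 2F 1F 0F
  }
fresh = paint true (equal 0F 0F)

-- Soundness of the colouring rules and structure of unforced colourings

module Structure {n} (G : Graph n) where
  open Graph G
  open Semantics G

  module _ {s} (sol : IsSolution s) where
    open IsSolution sol

    -- If `x` and `u` differed, `y` would agree with one of them, and the other would have two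
    -- neighbours of the opposite colour.
    triangle-same : ∀ {u x y} → Adj u x → Adj y x → Adj y u → s x ≡ s u
    triangle-same {u} {x} {y} ux yx yu with s x Bool.≟ s u
    ... | yes eq = eq
    ... | no sx≢su with s y Bool.≟ s u
    ...   | yes sy≡su = contradiction
                (opposite-unique (~-sym ux) (Bool.¬-not (sx≢su ∘ sym)) (~-sym yx)
                  (trans sy≡su (Bool.¬-not (sx≢su ∘ sym)))) (~⇒≢ yu)
    ...   | no sy≢su  = contradiction
                (opposite-unique ux (Bool.¬-not sx≢su) (~-sym yu) (Bool.¬-not sy≢su)) (~⇒≢ yx)

    module _ (τ : Fin n → Fin n) (τ-involutive : ∀ u → τ (τ u) ≡ u)
             (τ-adj : ∀ {u w} → Adj u w → Adj (τ u) (τ w)) where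

      transport : IsSolution (s ∘ τ)
      transport = record
        { partner  = λ u → τ (partner (τ u))
        ; adjacent = λ u → subst (λ z → Adj z (τ (partner (τ u)))) (τ-involutive u) (τ-adj (adjacent (τ u)))
        ; opposite = λ u → trans (cong s (τ-involutive _)) (opposite (τ u))
        ; unique   = λ {u} {w} uw sw →
            trans (sym (τ-involutive w)) (cong τ (unique (τ-adj uw) sw))
        }

  swap : Fin n → Fin n → Fin n → Fin n
  swap x y u with u Fin.≟ x
  ... | yes _ = y
  ... | no _ with u Fin.≟ y
  ...   | yes _ = x
  ...   | no _  = u

  swap-left : ∀ x y → swap x y x ≡ y
  swap-left x y with x Fin.≟ x
  ... | yes _ = refl
  ... | no x≢x = contradiction refl x≢x

  swap-right : ∀ x y → swap x y y ≡ x
  swap-right x y with y Fin.≟ x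
  ... | yes refl = refl
  ... | no _ with y Fin.≟ y
  ...   | yes _ = refl
  ...   | no y≢y = contradiction refl y≢y

  swap-other : ∀ {x y u} → u ≢ x → u ≢ y → swap x y u ≡ u
  swap-other {x} {y} {u} u≢x u≢y with u Fin.≟ x
  ... | yes u≡x = contradiction u≡x u≢x
  ... | no _ with u Fin.≟ y
  ...   | yes u≡y = contradiction u≡y u≢y
  ...   | no _ = refl

  swap-involutive : ∀ x y u → swap x y (swap x y u) ≡ u
  swap-involutive x y u with u Fin.≟ x
  ... | yes refl = swap-right x y
  ... | no u≢x with u Fin.≟ y
  ...   | yes refl = swap-left x y
  ...   | no u≢y   = swap-other u≢x u≢y

  module _ {x y} (twins : ∀ w → (Adj x w → Adj y w) × (Adj y w → Adj x w)) where

    -- Moving one end of an edge to its twin keeps the edge; doing this at both ends in turn shows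
    -- that the swap is an automorphism.
    swap-adjˡ : ∀ {u w} → Adj u w → Adj (swap x y u) w
    swap-adjˡ {u} uw with u Fin.≟ x
    ... | yes refl = proj₁ (twins _) uw
    ... | no _ with u Fin.≟ y
    ...   | yes refl = proj₂ (twins _) uw
    ...   | no _ = uw

    swap-adj : ∀ {u w} → Adj u w → Adj (swap x y u) (swap x y w)
    swap-adj uw = ~-sym (swap-adjˡ (~-sym (swap-adjˡ uw)))

  col-≢ : ∀ {c : Coloring n} {u w b} → c u ≡ nothing → c w ≡ just b → u ≢ w
  col-≢ cu cw refl = case trans (sym cu) cw of λ ()

  module _ {c : Coloring n} where

    -- In every case but the last the given solution already has colour `b` at `p`. For twins it may
    -- have to be replaced by another solution, which is why the conclusion asserts existence only.
    forcing-complete : ∀ b {p} → c p ≡ nothing → Sat c (forcing b) (p ▸ ⟨⟩) →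
      Solvable c → ∃[ s ] (IsSolution s × Extends c s × s p ≡ b)
    forcing-complete b {p} cp h (s , sol , ext) = go h
      where
      open IsSolution sol
      ext′ : ∀ {u} → c u ≡ just (not b) → not (s u) ≡ b
      ext′ cu = trans (cong not (ext cu)) (Bool.not-involutive b)

      go : Sat c (forcing b) (p ▸ ⟨⟩) → ∃[ s ] (IsSolution s × Extends c s × s p ≡ b)
      go (inj₁ (u , up , cu , w , uw , cw)) = s , sol , ext ,
        trans (others uw (trans (ext cw) (cong not (sym (ext cu)))) up (col-≢ cp cw)) (ext cu)
      go (inj₂ (inj₁ (u , w , wp , up , w≢u , cw , cu))) with s p Bool.≟ b
      ... | yes sp≡b = s , sol , ext , sp≡b
      ... | no sp≢b  = contradiction
              (opposite-unique (~-sym wp) (trans (ext cw) b≡) (~-sym up) (trans (ext cu) b≡))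
              (w≢u ∘ sym)
        where
        b≡ : b ≡ not (s p)
        b≡ = Bool.¬-not (sp≢b ∘ sym)
      go (inj₂ (inj₂ (inj₁ (u , up , cu , rest)))) with partner u Fin.≟ p
      ... | yes refl = s , sol , ext , trans (opposite u) (ext′ cu)
      ... | no ≢p    = contradiction
              (trans (ext (rest (partner u) (adjacent u) ≢p)) (sym (ext cu))) opposite-≢
      go (inj₂ (inj₂ (inj₂ (inj₁ (u , x , xu , xp , cu , rest))))) with rest (partner x) (adjacent x)
      go (inj₂ (inj₂ (inj₂ (inj₁ (u , x , xu , inj₂ refl , cu , rest))))) | inj₁ refl =
        s , sol , ext , trans (sym (Bool.not-involutive (s x))) (trans (cong not (sym (opposite x))) (ext′ cu))
      go (inj₂ (inj₂ (inj₂ (inj₁ (u , x , xu , inj₁ xp , cu , rest))))) | inj₁ refl =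
        s , sol , ext ,
        trans (others xu (opposite x) xp (col-≢ cp cu))
          (trans (sym (Bool.not-involutive (s x))) (trans (cong not (sym (opposite x))) (ext′ cu)))
      go (inj₂ (inj₂ (inj₂ (inj₁ (u , x , xu , inj₂ refl , cu , rest))))) | inj₂ e =
        contradiction (subst (Adj x) e (adjacent x)) ~-irrefl
      go (inj₂ (inj₂ (inj₂ (inj₁ (u , x , xu , inj₁ xp , cu , rest))))) | inj₂ refl =
        s , sol , ext ,
        trans (opposite x) (trans (cong not (sym (others (adjacent x) (opposite x) xu (col-≢ cp cu ∘ sym)))) (ext′ cu))
      go (inj₂ (inj₂ (inj₂ (inj₂ (inj₁ (u , y , up , cu , yp , yu)))))) =
        s , sol , ext , trans (triangle-same sol up yp yu) (ext cu)
      go (inj₂ (inj₂ (inj₂ (inj₂ (inj₂ (v , y , vp , vy , y≢p , cv , cy , rest , twins))))))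
        with rest (partner v) (adjacent v)
      ... | inj₁ refl        = s , sol , ext , trans (opposite v) (ext′ cv)
      -- Here `y` is the partner of `v`. Both `p` and `y` are uncoloured, so the swapped solution
      -- still extends `c`.
      ... | inj₂ (inj₁ refl) = s ∘ swap p y ,
              transport sol (swap p y) (swap-involutive p y) (swap-adj twins) ,
              (λ cu → trans (cong s (swap-other (col-≢ {c} cp cu ∘ sym) (col-≢ {c} cy cu ∘ sym))) (ext cu)) ,
              trans (cong s (swap-left p y)) (trans (opposite v) (ext′ cv))
      ... | inj₂ (inj₂ c≡)   = contradiction (trans (ext {partner v} c≡) (sym (ext cv))) opposite-≢
    -- If coloured vertices have no uncoloured neighbours, the colours of all
    -- uncoloured vertices may be exchanged.
    fresh-complete : ∀ {p} → c p ≡ nothing →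
      (∀ {u w b} → c u ≡ just b → Adj u w → c w ≢ nothing) →
      Solvable c → ∃[ s ] (IsSolution s × Extends c s × s p ≡ true)
    fresh-complete {p} cp closed (s , sol , ext) with s p in sp
    ... | true  = s , sol , ext , sp
    ... | false = s′ , sol′ , ext′ , sp′
      where
      open IsSolution sol
      flip : Maybe Bool → Bool → Bool
      flip nothing  b = not b
      flip (just _) b = b

      s′ : Fin n → Bool
      s′ u = flip (c u) (s u)

      -- An edge has both ends coloured or both uncoloured, so its ends are flipped together or not
      -- at all.
      flip-adj : ∀ {u w} → Adj u w → ∀ b → flip (c w) b ≡ flip (c u) b
      flip-adj {u} {w} uw b with c u in cu | c w in cw
      ... | nothing | nothing = refl
      ... | nothing | just _  = contradiction cu (closed cw (~-sym uw))
      ... | just _  | nothing = contradiction cw (closed cu uw)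
      ... | just _  | just _  = refl

      flip-not : ∀ m b → flip m (not b) ≡ not (flip m b)
      flip-not nothing  b = refl
      flip-not (just _) b = refl

      flip-injective : ∀ m {a b} → flip m a ≡ flip m b → a ≡ b
      flip-injective nothing  = Bool.not-injective
      flip-injective (just _) = id

      sol′ : IsSolution s′
      sol′ = record
        { partner  = partner
        ; adjacent = adjacent
        ; opposite = λ u → trans (flip-adj (adjacent u) _)
            (trans (cong (flip (c u)) (opposite u)) (flip-not (c u) (s u)))
        ; unique   = λ {u} {w} uw sw → unique uw (flip-injective (c u)
            (trans (sym (flip-adj uw (s w))) (trans sw (sym (flip-not (c u) (s u))))))
        }

      ext′ : Extends c s′
      ext′ {u} cu = trans (cong (λ m → flip m (s u)) cu) (ext cu)

      sp′ : s′ p ≡ true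
      sp′ = trans (cong (λ m → flip m (s p)) cp) (cong not sp)

    mate-sound : ∀ {k} {ρ : Vector (Fin n) k} {v x u} b {s} → IsSolution s → Extends c s →
      Adj (ρ v) (ρ x) → s (ρ x) ≡ not (s (ρ v)) → c (ρ u) ≡ nothing →
      Sat c (mate b v x u) ρ → s (ρ u) ≡ b
    mate-sound b {s} sol ext vx sx cu (inj₁ (cv , inj₁ (vu , u≢x))) =
      trans (IsSolution.others sol vx sx vu u≢x) (ext cv)
    mate-sound b {s} sol ext vx sx cu (inj₁ (cv , inj₂ (y , vy , y≢x , cy , yu , t , yt , ct))) =
      trans (others yt (trans (ext ct) (cong not (sym sy))) yu (col-≢ {c} cu ct)) sy
      where
      open IsSolution sol
      sy : s y ≡ b
      sy = trans (others vx sx vy y≢x) (ext cv)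
    mate-sound {ρ = ρ} {v} {x} {u} b {s} sol ext vx sx cu (inj₂ (cv , h)) = go h
      where
      open IsSolution sol
      sx′ : s (ρ x) ≡ b
      sx′ = trans sx (trans (cong not (ext cv)) (Bool.not-involutive b))
      go : _ → s (ρ u) ≡ b
      go (inj₁ u≡x)       = trans (cong s u≡x) sx′
      go (inj₂ (inj₁ xu)) =
        trans (others (~-sym vx) (trans (ext cv) (cong not (sym sx′))) xu (col-≢ {c} cu cv)) sx′
      go (inj₂ (inj₂ (y , t , vy , y≢x , cy , yt , ct , tu , u≢y))) =
        trans (others (~-sym yt) (trans sy (cong not (sym (ext ct)))) tu u≢y) (ext ct)
        where
        sy : s y ≡ not b
        sy = trans (others vx sx vy y≢x) (ext cv)

    Forced : Bool → Fin n → Set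
    Forced b x = c x ≡ nothing × Sat c (forcing b) (x ▸ ⟨⟩)

    module _ (unforced : ∀ b x → ¬ Forced b x) where

      -- The nested injections below pick the disjunct of `forcing` that would otherwise apply:
      -- `matched` in `not-opposite`, `triangle` in `no-triangle`, `two-alike` in `colored-unique`,
      -- `last` in `second`, and `degree-two` in `free₂`.
      module Boundary {v x b} (cv : c v ≡ just b) (vx : Adj v x) (cx : c x ≡ nothing) where

        cv′ : c v ≡ just (not (not b))
        cv′ = trans cv (cong just (sym (Bool.not-involutive b)))

        not-opposite : ∀ {w} → Adj v w → c w ≢ just (not b)
        not-opposite vw cw = unforced b x (cx , inj₁ (v , vx , cv , _ , vw , cw))

        no-triangle : ∀ {y} → Adj v y → ¬ Adj x y
        no-triangle vy xy = unforced b x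
          (cx , inj₂ (inj₂ (inj₂ (inj₂ (inj₁ (v , _ , vx , cv , ~-sym xy , ~-sym vy))))))

        colored-unique : ∀ {w} → Adj x w → c w ≡ just b → w ≡ v
        colored-unique {w} xw cw with w Fin.≟ v
        ... | yes w≡v = w≡v
        ... | no w≢v  = contradiction (cx , inj₂ (inj₁ (v , w , ~-sym xw , vx , w≢v , cw , cv))) (unforced b x)

        second : ∃[ y ] (Adj v y × y ≢ x × c y ≡ nothing)
        second with Fin.any? (λ y → (adj v y Bool.≟ true) ×-dec ¬? (y Fin.≟ x) ×-dec uncolored? c y)
        ... | yes h = h
        ... | no ¬h = contradiction (cx , inj₂ (inj₂ (inj₁ (v , vx , cv′ , rest)))) (unforced (not b) x)
          where
          rest : ∀ w → Adj v w → w ≢ x → c w ≡ just (not (not b))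
          rest w vw w≢x with c w in cw
          ... | nothing = contradiction (w , vw , w≢x , cw) ¬h
          ... | just a with a Bool.≟ not b
          ...   | yes refl = contradiction cw (not-opposite vw)
          ...   | no a≢    = cong just (Bool.¬-not a≢)

        Mixed : Set
        Mixed = ∃[ t ] (Adj x t × c t ≡ just (not b))

        mixed? : Dec Mixed
        mixed? = Fin.any? (λ t → (adj x t Bool.≟ true) ×-dec Maybe.≡-dec Bool._≟_ (c t) (just (not b)))

        Free₂ : Set
        Free₂ = ∃₂ λ z z′ → z ≢ z′ × (Adj x z × c z ≡ nothing) × (Adj x z′ × c z′ ≡ nothing)

        colored-neighbour : ¬ Mixed → ∀ {w a} → Adj x w → c w ≡ just a → w ≡ v
        colored-neighbour ¬t {w} {a} xw cw with a Bool.≟ b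
        ... | yes refl = colored-unique xw cw
        ... | no a≢b   = contradiction (w , xw , trans cw (cong just (Bool.¬-not a≢b))) ¬t

        -- When `x` is not mixed, its only coloured neighbour is `v`. With no uncoloured neighbour,
        -- `x` is a leaf and forced itself; with a single one `z`, it has degree two and `z` is
        -- forced to differ from `v`.
        free₂ : ¬ Mixed → Free₂
        free₂ ¬t with Fin.any? (λ z → (adj x z Bool.≟ true) ×-dec uncolored? c z)
        ... | no ¬z = contradiction
                (cx , inj₂ (inj₂ (inj₂ (inj₁ (v , x , ~-sym vx , inj₂ refl , cv′ , rest)))))
                (unforced (not b) x)
          where
          rest : ∀ w → Adj x w → w ≡ v ⊎ w ≡ x
          rest w xw with c w in cw
          ... | nothing = contradiction (w , xw , cw) ¬z
          ... | just _  = inj₁ (colored-neighbour ¬t xw cw)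
        ... | yes (z , xz , cz)
          with Fin.any? (λ z′ → ¬? (z Fin.≟ z′) ×-dec (adj x z′ Bool.≟ true) ×-dec uncolored? c z′)
        ...   | yes (z′ , z≢z′ , xz′ , cz′) = z , z′ , z≢z′ , (xz , cz) , (xz′ , cz′)
        ...   | no ¬z′ = contradiction
                (cz , inj₂ (inj₂ (inj₂ (inj₁ (v , x , ~-sym vx , inj₁ xz , cv′ , rest)))))
                (unforced (not b) z)
          where
          rest : ∀ w → Adj x w → w ≡ v ⊎ w ≡ z
          rest w xw with z Fin.≟ w | c w in cw
          ... | yes z≡w | _       = inj₂ (sym z≡w)
          ... | no z≢w  | nothing = contradiction (w , z≢w , xw , cw) ¬z′
          ... | no _    | just _  = inj₁ (colored-neighbour ¬t xw cw)

        -- u is coloured when x becomes the partner of v.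
        Reached : Fin n → Set
        Reached u = c u ≡ nothing × ∃[ a ] Sat c (mate a 2F 1F 0F) (u ▸ x ▸ v ▸ ⟨⟩)

        reached-self : Reached x
        reached-self = cx , not b , inj₂ (cv′ , inj₁ refl)

        reached-far : ∀ {u} → Adj x u → c u ≡ nothing → Reached u
        reached-far xu cu = cu , not b , inj₂ (cv′ , inj₂ (inj₁ xu))

        reached-near : ∀ {u} → Adj v u → u ≢ x → c u ≡ nothing → Reached u
        reached-near vu u≢x cu = cu , b , inj₁ (cv , inj₁ (vu , u≢x))

        module _ {y t} (vy : Adj v y) (y≢x : y ≢ x) (cy : c y ≡ nothing)
                 (yt : Adj y t) (ct : c t ≡ just (not b)) where

          reached-via : ∀ {u} → Adj y u → c u ≡ nothing → Reached u
          reached-via yu cu = cu , b , inj₁ (cv , inj₂ (y , vy , y≢x , cy , yu , t , yt , ct))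

          reached-across : ∀ {u} → Adj t u → u ≢ y → c u ≡ nothing → Reached u
          reached-across tu u≢y cu =
            cu , not b , inj₂ (cv′ , inj₂ (inj₂ (y , t , vy , y≢x , cy , yt , ct , tu , u≢y)))

        Drop : Rule → Fin n → Fin n → ℕ → Set
        Drop r p w k = k + #unc (recolor c r p w) ≤ #unc c

        -- All three rules recolour by the same `mate`. `at-mixed` branches at the uncoloured vertex
        -- over its coloured neighbours, so `p` and `w` exchange roles there.
        matching-drops : ∀ {xs} → Unique xs → (∀ {u} → u ∈ xs → Reached u) →
          Drop at-two v x (length xs) × Drop at-many v x (length xs) × Drop at-mixed x v (length xs)
        matching-drops xs! reached =
          #unc-drop {r = at-two} xs! reached ,
          #unc-drop {r = at-many} xs! reached ,
          #unc-drop {r = at-mixed} xs! reached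

      module _ {v x y b} (cv : c v ≡ just b) (vx : Adj v x) (vy : Adj v y) (x≢y : x ≢ y)
               (cx : c x ≡ nothing) (cy : c y ≡ nothing) where

        private
          module X = Boundary cv vx cx
          module Y = Boundary cv vy cy

        pair-reached : ∀ {u} → u ∈ x ∷ y ∷ [] → X.Reached u
        pair-reached (here refl)         = X.reached-self
        pair-reached (there (here refl)) = X.reached-near vy (x≢y ∘ sym) cy

        drop₂ : X.Drop at-two v x 2
        drop₂ = proj₁ (X.matching-drops ((x≢y ∷ []) ∷ [] ∷ []) pair-reached)

        third-reached : ∀ {z} → X.Reached z → ∀ {u} → u ∈ z ∷ x ∷ y ∷ [] → X.Reached u
        third-reached rz (here refl) = rz
        third-reached rz (there u∈)  = pair-reached u∈

        drop₃ : ∀ {z} → X.Reached z → z ≢ x → z ≢ y →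
          X.Drop at-two v x 3 × X.Drop at-many v x 3 × X.Drop at-mixed x v 3
        drop₃ rz z≢x z≢y =
          X.matching-drops ((z≢x ∷ z≢y ∷ []) ∷ (x≢y ∷ []) ∷ [] ∷ []) (third-reached rz)

        -- The two uncoloured neighbours of `x` are new: neither is `x`, and neither is `y`, since
        -- that would close a triangle with `v`.
        drop₄ : X.Free₂ → X.Drop at-two v x 4
        drop₄ (z , z′ , z≢z′ , (xz , cz) , (xz′ , cz′)) = proj₁ (X.matching-drops
          ((z≢z′ ∷ far xz ∷ far′ xz ∷ []) ∷ (far xz′ ∷ far′ xz′ ∷ []) ∷ (x≢y ∷ []) ∷ [] ∷ [])
          λ { (here refl) → X.reached-far xz cz ; (there u∈) → third-reached (X.reached-far xz′ cz′) u∈ })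
          where
          far : ∀ {w} → Adj x w → w ≢ x
          far xw refl = ~-irrefl xw
          far′ : ∀ {w} → Adj x w → w ≢ y
          far′ xw refl = X.no-triangle vy xw

        module _ (only : ∀ w → Adj v w → c w ≡ nothing → w ≡ x ⊎ w ≡ y) where

          -- If nothing else is reached, then x and y are twins.
          drop₃-mixed : X.Mixed → Y.Mixed → X.Drop at-two v x 3
          drop₃-mixed (t′ , xt′ , ct′) (t , yt , ct)
            with Fin.any? (λ z → (adj x z Bool.≟ true) ×-dec uncolored? c z)
          ... | yes (z , xz , cz) = proj₁ (drop₃ (X.reached-far xz cz) (~⇒≢ xz ∘ sym)
                  λ { refl → X.no-triangle vy xz })
          ... | no ¬xz with Fin.any? (λ z → (adj y z Bool.≟ true) ×-dec uncolored? c z)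
          ...   | yes (z , yz , cz) = proj₁ (drop₃ (X.reached-via vy (x≢y ∘ sym) cy yt ct yz cz)
                    (λ { refl → Y.no-triangle vx yz }) (~⇒≢ yz ∘ sym))
          -- The coloured vertex `t` has the uncoloured neighbour `y`, hence a second one. If that
          -- is not `x`, it is reached through `y` and `t`; otherwise `v` and `t` are both adjacent
          -- to `x` and to `y`.
          ...   | no ¬yz with u , tu , u≢y , cu ← Boundary.second ct (~-sym yt) cy with u Fin.≟ x
          ...     | no u≢x   = proj₁ (drop₃ (X.reached-across vy (x≢y ∘ sym) cy yt ct tu u≢y cu) u≢x u≢y)
          ...     | yes refl = contradiction
                      (cx , inj₂ (inj₂ (inj₂ (inj₂ (inj₂
                        (v , y , vx , vy , x≢y ∘ sym , X.cv′ , cy , rest , twins))))))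
                      (unforced (not b) x)
            where
            rest : ∀ w → Adj v w → w ≡ x ⊎ w ≡ y ⊎ c w ≡ just (not (not b))
            rest w vw with c w in cw
            ... | nothing = [ inj₁ , inj₂ ∘ inj₁ ]′ (only w vw cw)
            ... | just a with a Bool.≟ not b
            ...   | yes refl = contradiction cw (X.not-opposite vw)
            ...   | no a≢    = inj₂ (inj₂ (cong just (Bool.¬-not a≢)))

            -- With uncoloured neighbours excluded, `z` can be adjacent only to `v` and `t`, the
            -- unique neighbours of their colours, and both are adjacent to `z′`.
            common : ∀ {z z′} → Adj v z → Adj t z → c z ≡ nothing → Adj v z′ → Adj t z′ →
              ¬ (∃[ w ] (Adj z w × c w ≡ nothing)) → ∀ {w} → Adj z w → Adj z′ w
            common vz tz cz vz′ tz′ ¬zw {w} zw with c w in cw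
            ... | nothing = contradiction (w , zw , cw) ¬zw
            ... | just a with a Bool.≟ b
            ...   | yes refl with refl ← Boundary.colored-unique cv vz cz zw cw = ~-sym vz′
            ...   | no a≢b with refl ← Boundary.colored-unique ct tz cz zw
                        (trans cw (cong just (Bool.¬-not a≢b))) = ~-sym tz′

            twins : ∀ w → (Adj x w → Adj y w) × (Adj y w → Adj x w)
            twins w = common vx tu cx vy (~-sym yt) ¬xz , common vy (~-sym yt) cy vx tu ¬yz

-- Branching vectors

sum-bound : ∀ {A : Set} (f : A → ℕ) (m b : ℕ) (xs : List A) →
  (∀ {x} → x ∈ xs → f x * m ≤ b) → sum (map f xs) * m ≤ length xs * b
sum-bound f m b []       h = z≤n
sum-bound f m b (x ∷ xs) h = begin
  (f x + sum (map f xs)) * m    ≡⟨ ℕ.*-distribʳ-+ m (f x) _ ⟩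
  f x * m + sum (map f xs) * m  ≤⟨ ℕ.+-mono-≤ (h (here refl)) (sum-bound f m b xs (h ∘ there)) ⟩
  b + length xs * b             ∎
  where open ℕ.≤-Reasoning

-- With x = `P / Q`, the last three hypotheses say that the branching vectors (3,3), (2,4) and d
-- entries d + 2 have growth rate at most x, that is, 2/x^3 ≤ 1, 1/x^2 + 1/x^4 ≤ 1 and d/x^(d+2) ≤
-- 1, with denominators cleared.
module Rates (P Q : ℕ) .{{_ : NonZero P}} (Q≤P : Q ≤ P)
  (rate₃₃ : 2 * Q ^ 3 ≤ P ^ 3) (rate₂₄ : Q ^ 2 * P ^ 2 + Q ^ 4 ≤ P ^ 4)
  (rate-many : ∀ d → d * Q ^ (2 + d) ≤ P ^ (2 + d)) where

  -- (P/Q)^(-(u - u′)), scaled by P ^ u.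
  weight : ℕ → ℕ → ℕ
  weight u u′ = P ^ u′ * Q ^ (u ∸ u′)

  -- A drop by `k + o` instead of `k` only lowers the weight, because `Q ^ o ≤ P ^ o`.
  weight-drop : ∀ k {u u′} → k + u′ ≤ u → weight u u′ * P ^ k ≤ Q ^ k * P ^ u
  weight-drop k {u} {u′} k+u′≤u with o , refl ← ℕ.m≤n⇒∃[o]m+o≡n k+u′≤u = begin
    P ^ u′ * Q ^ (k + u′ + o ∸ u′) * P ^ k ≡⟨ cong (λ e → P ^ u′ * Q ^ e * P ^ k) exponent ⟩
    P ^ u′ * Q ^ (k + o) * P ^ k           ≡⟨ cong (λ e → P ^ u′ * e * P ^ k) (ℕ.^-distribˡ-+-* Q k o) ⟩
    P ^ u′ * (Q ^ k * Q ^ o) * P ^ k       ≡⟨ shuffle (P ^ u′) (Q ^ k) (Q ^ o) (P ^ k) ⟩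
    Q ^ k * (P ^ k * P ^ u′ * Q ^ o)       ≤⟨ ℕ.*-monoʳ-≤ (Q ^ k) (ℕ.*-monoʳ-≤ (P ^ k * P ^ u′) (ℕ.^-monoˡ-≤ o Q≤P)) ⟩
    Q ^ k * (P ^ k * P ^ u′ * P ^ o)       ≡⟨ cong (λ e → Q ^ k * (e * P ^ o)) (ℕ.^-distribˡ-+-* P k u′) ⟨
    Q ^ k * (P ^ (k + u′) * P ^ o)         ≡⟨ cong (Q ^ k *_) (ℕ.^-distribˡ-+-* P (k + u′) o) ⟨
    Q ^ k * P ^ (k + u′ + o)               ∎
    where
    open ℕ.≤-Reasoning
    exponent : k + u′ + o ∸ u′ ≡ k + o
    exponent = trans (cong (λ e → e + o ∸ u′) (ℕ.+-comm k u′))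
      (trans (cong (_∸ u′) (ℕ.+-assoc u′ k o)) (ℕ.m+n∸m≡n u′ (k + o)))
    shuffle : ∀ a b c d → a * (b * c) * d ≡ b * (d * a * c)
    shuffle = solve-∀

  module _ {n} (G : Graph n) where
    open Graph G
    open Semantics G
    open Structure G

    cost : Coloring n → Rule → Fin n → Fin n → ℕ
    cost c r p w = weight (#unc c) (#unc (recolor c r p w))

    Branched : Coloring n → Rule → Fin n → Set
    Branched c r p = ∃[ w ] (Sat c (Rule.branch r) (w ▸ p ▸ ⟨⟩) × Solvable (recolor c r p w))

    -- Completeness is asked in one direction only: colours are never overwritten, so a solution
    -- after recolouring always extends the old colouring. `decreasing` serves termination and
    -- `affordable` the time bound.
    record Valid (c : Coloring n) (r : Rule) (p : Fin n) : Set where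
      field
        complete   : Solvable c → Branched c r p
        decreasing : ∀ w → Sat c (Rule.branch r) (w ▸ p ▸ ⟨⟩) → #unc (recolor c r p w) < #unc c
        affordable : sum (map (cost c r p) (branches c r p)) ≤ P ^ #unc c

    module _ {c : Coloring n} {r : Rule} {p : Fin n} where
      open Rule r

      private
        u = #unc c
        f = cost c r p
        D : Fin n → ℕ → Set
        D w k = k + #unc (recolor c r p w) ≤ u

      branches⁻ : ∀ {w} → w ∈ branches c r p → Sat c branch (w ▸ p ▸ ⟨⟩)
      branches⁻ w∈ = proj₂ (∈-filter⁻ (λ w → sat? c branch (w ▸ p ▸ ⟨⟩)) {xs = allFin n} w∈)

      branches! : Unique (branches c r p)
      branches! = Unique.filter⁺ (λ w → sat? c branch (w ▸ p ▸ ⟨⟩)) (Unique.allFin⁺ n)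

      uniform : ∀ k d → (∀ {w} → w ∈ branches c r p → D w k) → length (branches c r p) ≤ d →
        d * Q ^ k ≤ P ^ k → sum (map f (branches c r p)) ≤ P ^ u
      uniform k d drops len rate = ℕ.*-cancelʳ-≤ _ _ (P ^ k) {{ℕ.m^n≢0 P k}} (begin
        sum (map f (branches c r p)) * P ^ k   ≤⟨ sum-bound f (P ^ k) _ (branches c r p) (λ w∈ → weight-drop k (drops w∈)) ⟩
        length (branches c r p) * (Q ^ k * P ^ u) ≤⟨ ℕ.*-monoˡ-≤ _ len ⟩
        d * (Q ^ k * P ^ u)                    ≡⟨ ℕ.*-assoc d _ _ ⟨
        d * Q ^ k * P ^ u                      ≤⟨ ℕ.*-monoˡ-≤ (P ^ u) rate ⟩
        P ^ k * P ^ u                          ≡⟨ ℕ.*-comm (P ^ k) _ ⟩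
        P ^ u * P ^ k                          ∎)
        where open ℕ.≤-Reasoning

      two-four : ∀ {x y} → branches c r p ⊆ x ∷ y ∷ [] → D x 2 → D y 4 →
        sum (map f (branches c r p)) ≤ P ^ u
      two-four {x} {y} sub dx dy = ℕ.*-cancelʳ-≤ _ _ (P ^ 4) {{ℕ.m^n≢0 P 4}} (begin
        sum (map f (branches c r p)) * P ^ 4        ≤⟨ ℕ.*-monoˡ-≤ (P ^ 4) (sum-mono-⊆ f branches! sub) ⟩
        (f x + (f y + 0)) * P ^ 4                   ≡⟨ cong (λ e → (f x + (f y + 0)) * e) (ℕ.^-distribˡ-+-* P 2 2) ⟩
        (f x + (f y + 0)) * (P ^ 2 * P ^ 2)         ≡⟨ shuffle (f x) (f y) (P ^ 2) ⟩
        f x * P ^ 2 * P ^ 2 + f y * (P ^ 2 * P ^ 2) ≡⟨ cong (λ e → f x * P ^ 2 * P ^ 2 + f y * e) (ℕ.^-distribˡ-+-* P 2 2) ⟨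
        f x * P ^ 2 * P ^ 2 + f y * P ^ 4           ≤⟨ ℕ.+-mono-≤ (ℕ.*-monoˡ-≤ (P ^ 2) (weight-drop 2 dx)) (weight-drop 4 dy) ⟩
        Q ^ 2 * P ^ u * P ^ 2 + Q ^ 4 * P ^ u       ≡⟨ collect (Q ^ 2) (P ^ u) (P ^ 2) (Q ^ 4) ⟩
        (Q ^ 2 * P ^ 2 + Q ^ 4) * P ^ u             ≤⟨ ℕ.*-monoˡ-≤ (P ^ u) rate₂₄ ⟩
        P ^ 4 * P ^ u                               ≡⟨ ℕ.*-comm (P ^ 4) _ ⟩
        P ^ u * P ^ 4                               ∎)
        where
        open ℕ.≤-Reasoning
        shuffle : ∀ a b e → (a + (b + 0)) * (e * e) ≡ a * e * e + b * (e * e)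
        shuffle = solve-∀
        collect : ∀ a b e d → a * b * e + d * b ≡ (a * e + d) * b
        collect = solve-∀

      single : ∀ {x} → branches c r p ⊆ x ∷ [] → (∀ {w} → w ∈ branches c r p → D w 1) →
        sum (map f (branches c r p)) ≤ P ^ u
      single sub drops = uniform 1 1 drops (length-mono-⊆ branches! sub)
        (ℕ.≤-trans (ℕ.≤-reflexive (ℕ.*-identityˡ (Q ^ 1))) (ℕ.^-monoˡ-≤ 1 Q≤P))

      two : ∀ {x y} → branches c r p ⊆ x ∷ y ∷ [] → D x 3 → D y 3 →
        sum (map f (branches c r p)) ≤ P ^ u
      two {x} {y} sub dx dy = uniform 3 2 (drops ∘ sub) (length-mono-⊆ branches! sub) rate₃₃
        where
        drops : ∀ {w} → w ∈ x ∷ y ∷ [] → D w 3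
        drops (here refl)         = dx
        drops (there (here refl)) = dy

    module _ {c : Coloring n} where

      Inapplicable : Rule → Set
      Inapplicable r = ∀ p → ¬ Sat c (Rule.guard r) (p ▸ ⟨⟩)

      module _ (φ : Formula 1) {p w u : Fin n} where

        paint-sat : ∀ b a → Sat c (Rule.to (paint b φ) a) (u ▸ w ▸ p ▸ ⟨⟩) → u ≡ p × b ≡ a
        paint-sat true  true  eq = eq , refl
        paint-sat true  false ≢  = contradiction refl ≢
        paint-sat false true  ≢  = contradiction refl ≢
        paint-sat false false eq = eq , refl

        sat-paint : ∀ b → Sat c (Rule.to (paint b φ) b) (p ▸ w ▸ p ▸ ⟨⟩)
        sat-paint true  = refl
        sat-paint false = refl

      paint-valid : ∀ b φ {p} → c p ≡ nothing →
        (Solvable c → ∃[ s ] (IsSolution s × Extends c s × s p ≡ b)) → Valid c (paint b φ) p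
      paint-valid b φ {p} cp compl = record
        { complete   = complete
        ; decreasing = λ w _ → drop w
        ; affordable = single {c} {paint b φ} {p}
            (λ w∈ → here (branches⁻ {c} {paint b φ} {p} w∈)) λ {w} _ → drop w
        }
        where
        drop : ∀ w → 1 + #unc (recolor c (paint b φ) p w) ≤ #unc c
        drop w = #unc-drop {r = paint b φ} ([] ∷ []) λ { (here refl) → cp , b , sat-paint φ {p} {w} {p} b }
        complete : Solvable c → Branched c (paint b φ) p
        complete sv with s , sol , ext , sp ← compl sv =
          p , refl , s , sol , recolor-extends {r = paint b φ} ext λ {u} a _ t →
            let u≡p , b≡a = paint-sat φ {p} {p} {u} b a t in trans (cong s u≡p) (trans sp b≡a)

      colored : ∀ {v} → c v ≢ nothing → ∃[ b ] c v ≡ just b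
      colored {v} cv with c v
      ... | nothing = contradiction refl cv
      ... | just b  = b , refl

      forcing-valid : ∀ b p → Sat c (Rule.guard (paint b (forcing b))) (p ▸ ⟨⟩) →
        Valid c (paint b (forcing b)) p
      forcing-valid b p (cp , h) = paint-valid b (forcing b) cp (forcing-complete b cp h)

      fresh-valid : Inapplicable at-many → ∀ p → Sat c (Rule.guard fresh) (p ▸ ⟨⟩) → Valid c fresh p
      fresh-valid na p (cp , _) = paint-valid true (equal 0F 0F) cp
        (fresh-complete cp λ {u} {w} cu uw cw → na u ((λ cu′ → col-≢ {c} cu′ cu refl) , w , uw , cw))

      module _ (unforced : ∀ b → Inapplicable (paint b (forcing b))) where

        -- The solution itself tells which branch to take. The partner of `v` is uncoloured, since a
        -- coloured one would have the colour that `not-opposite` excludes.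
        partner-complete : ∀ {v x} → c v ≢ nothing → Adj v x → c x ≡ nothing → Solvable c →
          ∃[ w ] ((Adj v w × c w ≡ nothing) × Solvable (recolor c at-two v w) × Solvable (recolor c at-many v w))
        partner-complete {v} {x} cv≢ vx cx (s , sol , ext) =
          partner v , (adjacent v , unc) ,
          (s , sol , recolor-extends {r = at-two} ext (sound at-two refl)) ,
          (s , sol , recolor-extends {r = at-many} ext (sound at-many refl))
          where
          open IsSolution sol
          sound : ∀ r → Rule.to r ≡ (λ b → mate b 2F 1F 0F) →
            ∀ {u} b → c u ≡ nothing → Sat c (Rule.to r b) (u ▸ partner v ▸ v ▸ ⟨⟩) → s u ≡ b
          sound r refl {u} b cu =
            mate-sound {ρ = u ▸ partner v ▸ v ▸ ⟨⟩} {2F} {1F} {0F} b sol ext (adjacent v) (opposite v) cu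
          unc : c (partner v) ≡ nothing
          unc with b , cv ← colored cv≢ with c (partner v) in cp
          ... | nothing = refl
          ... | just a  = contradiction
                (trans cp (cong just (trans (sym (ext cp)) (trans (opposite v) (cong not (ext cv))))))
                (Boundary.not-opposite unforced cv vx cx (adjacent v))

        at-two-valid : ∀ p → Sat c (Rule.guard at-two) (p ▸ ⟨⟩) → Valid c at-two p
        at-two-valid v (cv≢ , x , y , vx , vy , x≢y , cx , cy , only) with b , cv ← colored cv≢ = record
          { complete   = λ sv → let w , h , sv′ , _ = partner-complete cv≢ vx cx sv in w , h , sv′
          ; decreasing = decreasing
          ; affordable = affordable
          }
          where
          module X = Boundary unforced cv vx cx
          module Y = Boundary unforced cv vy cy
          only′ : ∀ w → Adj v w → c w ≡ nothing → w ≡ y ⊎ w ≡ x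
          only′ w vw cw = [ inj₂ , inj₁ ]′ (only w vw cw)
          x₂ = drop₂ unforced cv vx vy x≢y cx cy
          y₂ = drop₂ unforced cv vy vx (x≢y ∘ sym) cy cx
          decreasing : ∀ w → Adj v w × c w ≡ nothing → #unc (recolor c at-two v w) < #unc c
          decreasing w (vw , cw) with only w vw cw
          ... | inj₁ refl = ℕ.≤-trans (ℕ.n≤1+n _) x₂
          ... | inj₂ refl = ℕ.≤-trans (ℕ.n≤1+n _) y₂
          within : branches c at-two v ⊆ x ∷ y ∷ []
          within w∈ with vw , cw ← branches⁻ {c} {at-two} w∈ with only _ vw cw
          ... | inj₁ refl = here refl
          ... | inj₂ refl = there (here refl)
          within′ : branches c at-two v ⊆ y ∷ x ∷ []
          within′ w∈ with within w∈
          ... | here refl         = there (here refl)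
          ... | there (here refl) = here refl
          affordable : sum (map (cost c at-two v) (branches c at-two v)) ≤ P ^ #unc c
          -- An unmixed neighbour has two uncoloured neighbours, so choosing it as the partner
          -- colours four vertices, while the other choice still colours `x` and `y`.
          affordable with X.mixed? | Y.mixed?
          ... | yes tx | yes ty = two {c} {at-two} within
                  (drop₃-mixed unforced cv vx vy x≢y cx cy only tx ty)
                  (drop₃-mixed unforced cv vy vx (x≢y ∘ sym) cy cx only′ ty tx)
          ... | _      | no ¬ty = two-four {c} {at-two} within x₂
                  (drop₄ unforced cv vy vx (x≢y ∘ sym) cy cx (Y.free₂ ¬ty))
          ... | no ¬tx | _      = two-four {c} {at-two} within′ y₂
                  (drop₄ unforced cv vx vy x≢y cx cy (X.free₂ ¬tx))

        module _ (no-two : Inapplicable at-two) where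

          -- Besides `x` and the second uncoloured neighbour, `v` has a third one, as otherwise
          -- `at-two` would apply. Choosing `x` as the partner colours all three.
          three : ∀ {v x b} (cv : c v ≡ just b) (vx : Adj v x) (cx : c x ≡ nothing) →
            Boundary.Drop unforced cv vx cx at-mixed x v 3
          three {v} {x} cv vx cx with y , vy , y≢x , cy ← Boundary.second unforced cv vx cx
            with Fin.any? (λ z → (adj v z Bool.≟ true) ×-dec uncolored? c z ×-dec ¬? (z Fin.≟ x) ×-dec ¬? (z Fin.≟ y))
          ... | yes (z , vz , cz , z≢x , z≢y) = proj₂ (proj₂
                  (drop₃ unforced cv vx vy (y≢x ∘ sym) cx cy (Boundary.reached-near unforced cv vx cx vz z≢x cz) z≢x z≢y))
          ... | no ¬z = contradiction
                  ((λ cv′ → col-≢ {c} cv′ cv refl) , x , y , vx , vy , y≢x ∘ sym , cx , cy , only)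
                  (no-two v)
            where
            only : ∀ w → Adj v w → c w ≡ nothing → w ≡ x ⊎ w ≡ y
            only w vw cw with w Fin.≟ x | w Fin.≟ y
            ... | yes w≡x | _       = inj₁ w≡x
            ... | _       | yes w≡y = inj₂ w≡y
            ... | no w≢x  | no w≢y  = contradiction (w , vw , cw , w≢x , w≢y) ¬z

          at-mixed-valid : ∀ p → Sat c (Rule.guard at-mixed) (p ▸ ⟨⟩) → Valid c at-mixed p
          at-mixed-valid x (cx , (v , xv , cv) , (t , xt , ct)) = record
            { complete   = complete
            ; decreasing = λ w (xw , cw≢) → ℕ.≤-trans (ℕ.m≤n+m _ 2) (three (proj₂ (colored cw≢)) (~-sym xw) cx)
            ; affordable = two {c} {at-mixed} within (three cv (~-sym xv) cx) (three ct (~-sym xt) cx)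
            }
            where
            within : branches c at-mixed x ⊆ v ∷ t ∷ []
            within w∈ with xw , cw≢ ← branches⁻ {c} {at-mixed} w∈ with colored cw≢
            ... | true  , cw = here (Boundary.colored-unique unforced cv (~-sym xv) cx xw cw)
            ... | false , cw = there (here (Boundary.colored-unique unforced ct (~-sym xt) cx xw cw))
            complete : Solvable c → Branched c at-mixed x
            complete (s , sol , ext) = choose (s x) refl
              where
              open IsSolution sol
              at : ∀ {w b} → Adj x w → c w ≡ just b → s x ≡ not b →
                Branched c at-mixed x
              at {w} {b} xw cw sx = w , (xw , λ cw′ → col-≢ {c} cw′ cw refl) , s , sol ,
                recolor-extends {r = at-mixed} ext λ {u} a cu →
                  mate-sound {ρ = u ▸ w ▸ x ▸ ⟨⟩} {1F} {2F} {0F} a sol ext (~-sym xw)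
                    (trans sx (cong not (sym (ext cw)))) cu
              -- Since `x` has neighbours of both colours, its partner is the one whose colour
              -- differs from that of `x`.
              choose : ∀ a → s x ≡ a → Branched c at-mixed x
              choose true  sx = at xt ct sx
              choose false sx = at xv cv sx

          module _ (no-mixed : Inapplicable at-mixed) where

            unmixed : ∀ {v x} b (cv : c v ≡ just b) (vx : Adj v x) (cx : c x ≡ nothing) →
              ¬ Boundary.Mixed unforced cv vx cx
            unmixed true  cv vx cx (t , xt , ct) = no-mixed _ (cx , (_ , ~-sym vx , cv) , (t , xt , ct))
            unmixed false cv vx cx (t , xt , ct) = no-mixed _ (cx , (t , xt , ct) , (_ , ~-sym vx , cv))

            at-many-valid : ∀ p → Sat c (Rule.guard at-many) (p ▸ ⟨⟩) → Valid c at-many p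
            at-many-valid v (cv≢ , x , vx , cx) with b , cv ← colored cv≢ = record
              { complete   = λ sv → let w , h , _ , sv′ = partner-complete cv≢ vx cx sv in w , h , sv′
              ; decreasing = λ w h → ℕ.≤-trans (s≤s (ℕ.m≤n+m _ (1 + d))) (drop h)
              ; affordable = uniform {c} {at-many} (2 + d) d
                  (λ w∈ → drop (branches⁻ {c} {at-many} w∈)) ℕ.≤-refl (rate-many d)
              }
              where
              d = length (branches c at-many v)
              drop : ∀ {w} → Adj v w × c w ≡ nothing → 2 + d + #unc (recolor c at-many v w) ≤ #unc c
              drop {w} (vw , cw)
                with z , z′ , z≢z′ , (wz , cz) , (wz′ , cz′) ← Boundary.free₂ unforced cv vw cw (unmixed b cv vw cw) =
                proj₁ (proj₂ (W.matching-drops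
                  ((z≢z′ ∷ All.tabulate (λ u∈ → λ { refl → far wz u∈ })) ∷
                   All.tabulate (λ u∈ → λ { refl → far wz′ u∈ }) ∷ branches! {c} {at-many}) reached))
                where
                module W = Boundary unforced cv vw cw
                -- A neighbour of `w` among the branches would form a triangle with `v`, so `z` and
                -- `z′` come on top of the `d` vertices.
                far : ∀ {z} → Adj w z → ¬ (z ∈ branches c at-many v)
                far wz z∈ = W.no-triangle (proj₁ (branches⁻ {c} {at-many} z∈)) wz
                reached : ∀ {u} → u ∈ z ∷ z′ ∷ branches c at-many v → W.Reached u
                reached (here refl)         = W.reached-far wz cz
                reached (there (here refl)) = W.reached-far wz′ cz′
                reached {u} (there (there u∈)) with vu , cu ← branches⁻ {c} {at-many} u∈ with u Fin.≟ w
                ... | yes refl = W.reached-self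
                ... | no u≢w   = W.reached-near vu u≢w cu

-- The program

unary : ℕ → Tree
unary zero    = nil
unary (suc i) = cons nil (unary i)

⌜_⌝ : ∀ {n} → Fin n → Tree
⌜ v ⌝ = unary (toℕ v)

encodeColor : Maybe Bool → Tree
encodeColor nothing  = nil
encodeColor (just b) = cons (encodeBool b) nil

neg-code : Tree → Tree
neg-code t = cons (unary 3) t

and-code : Tree → Tree → Tree
and-code s t = cons (unary 4) (cons s t)

ex-code : Tree → Tree
ex-code t = cons (unary 5) t

-- The remaining connectives are expressed by negation, conjunction and `ex`, so the interpreter has
-- six tags. Agreement with `Sat` then rests on decidability.
code : ∀ {k} → Formula k → Tree
code (edge i j)  = cons (unary 0) (cons ⌜ i ⌝ ⌜ j ⌝)
code (equal i j) = cons (unary 1) (cons ⌜ i ⌝ ⌜ j ⌝)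
code (col m i)   = cons (unary 2) (cons (encodeColor m) ⌜ i ⌝)
code (neg φ)     = neg-code (code φ)
code (φ ∧ ψ)     = and-code (code φ) (code ψ)
code (φ ∨ ψ)     = neg-code (and-code (neg-code (code φ)) (neg-code (code ψ)))
code (φ ⇒ ψ)     = neg-code (and-code (code φ) (neg-code (code ψ)))
code (ex φ)      = ex-code (code φ)
code (all φ)     = neg-code (ex-code (neg-code (code φ)))

rule-code : Rule → Tree
rule-code r = cons (code guard) (cons (code branch) (cons (code (to true)) (code (to false))))
  where open Rule r

pattern nth    = 0F
pattern same   = 1F
pattern eval   = 2F
pattern find   = 3F
pattern update = 4F
pattern solve  = 5F
pattern try    = 6F
pattern search = 7F
pattern index  = 8F
pattern blank  = 9F

arities : Fin 10 → ℕ
arities nth    = 2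
arities same   = 2
arities eval   = 5
arities find   = 6
arities update = 7
arities solve  = 3
arities try    = 4
arities search = 6
arities index  = 2
arities blank  = 1

E : ℕ → Set
E = Exp arities

infix 20 #_

#_ : ∀ {k} m {m<k : True (m ℕ.<? k)} → E k
#_ m {m<k} = var (Fin.#_ m {m<n = m<k})

quoted : ∀ {k} → Tree → E k
quoted nil        = nil
quoted (cons s t) = cons (quoted s) (quoted t)

-- Truth values are nil and any pair.
truth : ∀ {k} → E k
truth = cons nil nil

nth-body same-body index-body : E 2
nth-body =
  case (# 1) (case (# 0) nil (# 0))
    (case (# 2) nil (call nth (# 1 ∷ # 3 ∷ [])))
same-body =
  case (# 0) (case (# 1) truth nil)
    (case (# 3) nil
      (case (call same (# 2 ∷ # 0 ∷ [])) nil (call same (# 5 ∷ # 3 ∷ []))))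
index-body = case (# 0) nil (cons (# 3) (call index (# 1 ∷ cons nil (# 3) ∷ [])))

blank-body : E 1
blank-body = case (# 0) nil (cons nil (call blank (# 1 ∷ [])))

module _ {k} (arg env G V C : Fin k) where

  eval-edge eval-equal eval-col eval-neg eval-and eval-ex : E k
  eval-edge = case (var arg) nil
    (call nth (call nth (var (suc (suc G)) ∷ call nth (var (suc (suc env)) ∷ # 0 ∷ []) ∷ []) ∷
               call nth (var (suc (suc env)) ∷ # 1 ∷ []) ∷ []))
  eval-equal = case (var arg) nil
    (call same (call nth (var (suc (suc env)) ∷ # 0 ∷ []) ∷
                call nth (var (suc (suc env)) ∷ # 1 ∷ []) ∷ []))
  eval-col = case (var arg) nil
    (call same (# 0 ∷ call nth (var (suc (suc C)) ∷ call nth (var (suc (suc env)) ∷ # 1 ∷ []) ∷ []) ∷ []))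
  eval-neg = case (call eval (var arg ∷ var env ∷ var G ∷ var V ∷ var C ∷ [])) truth nil
  eval-and = case (var arg) nil
    (case (call eval (# 0 ∷ var (suc (suc env)) ∷ var (suc (suc G)) ∷ var (suc (suc V)) ∷ var (suc (suc C)) ∷ []))
      nil
      (call eval (# 3 ∷ var (suc (suc (suc (suc env)))) ∷ var (suc (suc (suc (suc G)))) ∷
                  var (suc (suc (suc (suc V)))) ∷ var (suc (suc (suc (suc C)))) ∷ [])))
  eval-ex = call find (var V ∷ var arg ∷ var env ∷ var G ∷ var V ∷ var C ∷ [])

-- A pair of variables for the tag is bound at each level.
eval-body : E 5
eval-body =
  case (# 0) nil
  (case (# 0) (eval-edge (Fin.# 1) (Fin.# 3) (Fin.# 4) (Fin.# 5) (Fin.# 6))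
  (case (# 1) (eval-equal (Fin.# 3) (Fin.# 5) (Fin.# 6) (Fin.# 7) (Fin.# 8))
  (case (# 1) (eval-col (Fin.# 5) (Fin.# 7) (Fin.# 8) (Fin.# 9) (Fin.# 10))
  (case (# 1) (eval-neg (Fin.# 7) (Fin.# 9) (Fin.# 10) (Fin.# 11) (Fin.# 12))
  (case (# 1) (eval-and (Fin.# 9) (Fin.# 11) (Fin.# 12) (Fin.# 13) (Fin.# 14))
  (eval-ex (Fin.# 11) (Fin.# 13) (Fin.# 14) (Fin.# 15) (Fin.# 16)))))))

find-body : E 6
find-body = case (# 0) nil
  (case (call eval (# 3 ∷ cons (# 0) (# 4) ∷ # 5 ∷ # 6 ∷ # 7 ∷ []))
    (call find (# 1 ∷ # 3 ∷ # 4 ∷ # 5 ∷ # 6 ∷ # 7 ∷ []))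
    (cons (# 2) nil))

update-one : E 9
update-one = case (call nth (# 8 ∷ # 0 ∷ []))
  (case (call eval (# 3 ∷ cons (# 0) (# 5) ∷ # 6 ∷ # 7 ∷ # 8 ∷ []))
    (case (call eval (# 4 ∷ cons (# 0) (# 5) ∷ # 6 ∷ # 7 ∷ # 8 ∷ [])) nil
      (cons nil nil))
    (cons truth nil))
  (cons (# 0) (# 1))

update-body : E 7
update-body = case (# 0) nil
  (cons update-one (call update (# 1 ∷ # 3 ∷ # 4 ∷ # 5 ∷ # 6 ∷ # 7 ∷ # 8 ∷ [])))

-- The first rule whose guard holds somewhere settles the answer at the vertex found: its branches
-- are complete, so there is no return to another vertex or a later rule.
try-body : Tree → E 4
try-body final = case (# 0) (call eval (quoted final ∷ nil ∷ # 1 ∷ # 2 ∷ # 3 ∷ []))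
  (case (# 0) nil
    (case (call find (# 6 ∷ # 0 ∷ nil ∷ # 5 ∷ # 6 ∷ # 7 ∷ []))
      (call try (# 3 ∷ # 5 ∷ # 6 ∷ # 7 ∷ []))
      (call search (# 8 ∷ # 3 ∷ # 0 ∷ # 7 ∷ # 8 ∷ # 9 ∷ []))))

search-body : E 6
search-body = case (# 0) nil
  (case (# 3) nil
    (case (# 1) nil
      (case (call eval (# 2 ∷ cons (# 4) (cons (# 8) nil) ∷ # 9 ∷ # 10 ∷ # 11 ∷ []))
        (call search (# 5 ∷ # 7 ∷ # 8 ∷ # 9 ∷ # 10 ∷ # 11 ∷ []))
        (case (call solve (# 11 ∷ # 12 ∷
                call update (# 12 ∷ # 2 ∷ # 3 ∷ cons (# 6) (cons (# 10) nil) ∷ # 11 ∷ # 12 ∷ # 13 ∷ []) ∷ []))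
          (call search (# 7 ∷ # 9 ∷ # 10 ∷ # 11 ∷ # 12 ∷ # 13 ∷ []))
          truth))))

program : Tree → Tree → Program
program rules final = record
  { arity = arities
  ; body  = λ where
      nth    → nth-body
      same   → same-body
      eval   → eval-body
      find   → find-body
      update → update-body
      solve  → call try (quoted rules ∷ # 0 ∷ # 1 ∷ # 2 ∷ [])
      try    → try-body final
      search → search-body
      index  → index-body
      blank  → blank-body
  -- The empty graph must be rejected beforehand: its empty colouring is vacuously a solution, but a
  -- cut needs a vertex on each side.
  ; main  = case (# 0) nil
      (case (call solve (# 2 ∷ call index (# 2 ∷ nil ∷ []) ∷ call blank (# 2 ∷ []) ∷ [])) nil truth)
  }

-- Running times

module Execution (rules final : Tree) where
  open Program (program rules final)
  open Evaluation (program rules final)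

  -- e evaluates to v in at most k + b steps; k collects the constants.
  record Run {m} (ρ : Vec Tree m) (e : E m) (v : Tree) (k b : ℕ) : Set where
    constructor run
    field
      {steps} : ℕ
      eval⇓   : ρ ⊢ e ⇓ v ∣ steps
      bound   : steps ≤ k + b

  record Run* {m j} (ρ : Vec Tree m) (es : Vec (E m) j) (vs : Vec Tree j) (k b : ℕ) : Set where
    constructor run
    field
      {steps} : ℕ
      eval⇓   : ρ ⊢ es ⇓* vs ∣ steps
      bound   : steps ≤ k + b

  add : ∀ {s t} k b l c → s ≤ k + b → t ≤ l + c → s + t ≤ k + l + (b + c)
  add k b l c s≤ t≤ = ℕ.≤-trans (ℕ.+-mono-≤ s≤ t≤) (ℕ.≤-reflexive (interchange k b l c))
    where
    interchange : ∀ k b l c → k + b + (l + c) ≡ k + l + (b + c)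
    interchange = solve-∀

  module _ {m} {ρ : Vec Tree m} where

    var⁺ : ∀ i → Run ρ (var i) (lookup ρ i) 1 0
    var⁺ i = run (var i) ℕ.≤-refl

    #⁺_ : ∀ i {i<m : True (i ℕ.<? m)} → Run ρ (#_ i {i<m}) (lookup ρ (Fin.#_ i {m<n = i<m})) 1 0
    #⁺_ i = var⁺ _

    nil⁺ : Run ρ nil nil 1 0
    nil⁺ = run nil ℕ.≤-refl

    cons⁺ : ∀ {e₁ e₂ v₁ v₂ k b l c} → Run ρ e₁ v₁ k b → Run ρ e₂ v₂ l c →
      Run ρ (cons e₁ e₂) (cons v₁ v₂) (suc (k + l)) (b + c)
    cons⁺ {k = k} {b} {l} {c} (run p p≤) (run q q≤) = run (cons p q) (s≤s (add k b l c p≤ q≤))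

    case-nil⁺ : ∀ {e e₁ e₂ v k b l c} → Run ρ e nil k b → Run ρ e₁ v l c →
      Run ρ (case e e₁ e₂) v (suc (k + l)) (b + c)
    case-nil⁺ {k = k} {b} {l} {c} (run p p≤) (run q q≤) = run (case-nil p q) (s≤s (add k b l c p≤ q≤))

    case-cons⁺ : ∀ {e e₁ e₂ x y v k b l c} → Run ρ e (cons x y) k b → Run (x ∷ y ∷ ρ) e₂ v l c →
      Run ρ (case e e₁ e₂) v (suc (k + l)) (b + c)
    case-cons⁺ {k = k} {b} {l} {c} (run p p≤) (run q q≤) = run (case-cons p q) (s≤s (add k b l c p≤ q≤))

    call⁺ : ∀ f {es vs v k b l c} → Run* ρ es vs k b → Run vs (body f) v l c →
      Run ρ (call f es) v (suc (k + l)) (b + c)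
    call⁺ f {k = k} {b} {l} {c} (run p p≤) (run q q≤) = run (call p q) (s≤s (add k b l c p≤ q≤))

    [_]⁺ : ∀ {e v k b} → Run ρ e v k b → Run* ρ (e ∷ []) (v ∷ []) k b
    [ run p p≤ ]⁺ = run (p ∷ []) (ℕ.≤-trans (ℕ.≤-reflexive (ℕ.+-identityʳ _)) p≤)

    infixr 5 _∷⁺_
    _∷⁺_ : ∀ {j e v k b l c} {es : Vec (E m) j} {vs} → Run ρ e v k b → Run* ρ es vs l c →
      Run* ρ (e ∷ es) (v ∷ vs) (k + l) (b + c)
    _∷⁺_ {k = k} {b} {l} {c} (run p p≤) (run q q≤) = run (p ∷ q) (add k b l c p≤ q≤)

    -- The constant collected along a concrete derivation is a numeral, so its comparison with a
    -- convenient bound `k′` is settled by evaluation. The constants in the cost functions are such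
    -- rounded bounds.
    pack : ∀ {e v k b} k′ {k≤ : True (k ℕ.≤? k′)} {b′} → b ≤ b′ → Run ρ e v k b → Run ρ e v 0 (k′ + b′)
    pack k′ {k≤} b≤ (run p p≤) = run p (ℕ.≤-trans p≤ (ℕ.+-mono-≤ (toWitness k≤) b≤))

    relax : ∀ {e v k b b′} → b ≤ b′ → Run ρ e v k b → Run ρ e v k b′
    relax {k = k} b≤ (run p p≤) = run p (ℕ.≤-trans p≤ (ℕ.+-monoʳ-≤ k b≤))

    quoted⁺ : ∀ t → Run ρ (quoted t) t 0 (size t)
    quoted⁺ nil        = run nil ℕ.≤-refl
    quoted⁺ (cons s t) with run p p≤ ← quoted⁺ s | run q q≤ ← quoted⁺ t =
      run (cons p q) (s≤s (ℕ.+-mono-≤ p≤ q≤))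

  nth⁺ : ∀ {m} (f : Fin m → Tree) i →
    Run (encodeList (tabulate f) ∷ ⌜ i ⌝ ∷ []) (body nth) (f i) 0 (m * 7)
  nth⁺ {suc m} f zero    = pack 7 z≤n (case-nil⁺ (#⁺ 1) (case-cons⁺ (#⁺ 0) (#⁺ 0)))
  nth⁺ {suc m} f (suc i) = pack 7 ℕ.≤-refl (case-cons⁺ (#⁺ 1) (case-cons⁺ (#⁺ 2)
    (call⁺ nth (#⁺ 1 ∷⁺ [ #⁺ 3 ]⁺) (nth⁺ (f ∘ suc) i))))

  data Verdict (P : Set) : Tree → Set where
    rejects  : ¬ P → Verdict P nil
    accepts : ∀ {s t} → P → Verdict P (cons s t)

  Verdict-map : ∀ {P R v} → (P → R) → (R → P) → Verdict P v → Verdict R v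
  Verdict-map f g (rejects ¬p) = rejects (¬p ∘ g)
  Verdict-map f g (accepts p) = accepts (f p)

  truth⁺ : ∀ {m} {ρ : Vec Tree m} → Run ρ truth (cons nil nil) 3 0
  truth⁺ = cons⁺ nil⁺ nil⁺

  -- Both trees are descended in parallel, so the size of the first alone bounds the time.
  same⁺ : ∀ s t → ∃[ v ] (Run (s ∷ t ∷ []) (body same) v 0 (size s * 15) × Verdict (s ≡ t) v)
  same⁺ nil nil = _ , pack 15 z≤n (case-nil⁺ (#⁺ 0) (case-nil⁺ (#⁺ 1) truth⁺)) , accepts refl
  same⁺ nil (cons _ _) = _ , pack 15 z≤n (case-nil⁺ (#⁺ 0) (case-cons⁺ (#⁺ 1) nil⁺)) , rejects λ ()
  same⁺ (cons s t) nil = _ , pack 15 z≤n (case-cons⁺ (#⁺ 0) (case-nil⁺ (#⁺ 3) nil⁺)) , rejects λ ()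
  same⁺ (cons s t) (cons s′ t′) with same⁺ s s′
  ... | _ , r , rejects s≢ = _ , pack 15
          (ℕ.≤-trans (ℕ.≤-reflexive (ℕ.+-identityʳ _)) (ℕ.*-monoˡ-≤ 15 (ℕ.m≤m+n (size s) (size t))))
          (case-cons⁺ (#⁺ 0) (case-cons⁺ (#⁺ 3) (case-nil⁺ (call⁺ same (#⁺ 2 ∷⁺ [ #⁺ 0 ]⁺) r) nil⁺))) ,
          rejects λ { refl → s≢ refl }
  ... | _ , r , accepts refl with v , r′ , d ← same⁺ t t′ = v , pack 15
          (ℕ.≤-reflexive (sym (ℕ.*-distribʳ-+ 15 (size s) (size t))))
          (case-cons⁺ (#⁺ 0) (case-cons⁺ (#⁺ 3) (case-cons⁺ (call⁺ same (#⁺ 2 ∷⁺ [ #⁺ 0 ]⁺) r)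
            (call⁺ same (#⁺ 5 ∷⁺ [ #⁺ 3 ]⁺) r′)))) ,
          Verdict-map (cong (cons s)) (λ { refl → refl }) d

-- Encodings, cost functions and the formula interpreter

unary-injective : ∀ {i j} → unary i ≡ unary j → i ≡ j
unary-injective {zero}  {zero}  _  = refl
unary-injective {suc i} {suc j} eq = cong suc (unary-injective (right-injective eq))
  where
  right-injective : ∀ {s t s′ t′} → Tree.cons s t ≡ Tree.cons s′ t′ → t ≡ t′
  right-injective refl = refl

⌜⌝-injective : ∀ {n} {u v : Fin n} → ⌜ u ⌝ ≡ ⌜ v ⌝ → u ≡ v
⌜⌝-injective = Fin.toℕ-injective ∘ unary-injective

size-unary : ∀ i → size (unary i) ≡ suc (i * 2)
size-unary zero    = refl
size-unary (suc i) = cong (2 +_) (size-unary i)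

size-⌜⌝ : ∀ {n} (v : Fin n) → size ⌜ v ⌝ ≤ n * 2
size-⌜⌝ {suc n} v = ℕ.≤-trans (ℕ.≤-reflexive (size-unary (toℕ v)))
  (s≤s (ℕ.m≤n⇒m≤1+n (ℕ.*-monoˡ-≤ 2 (ℕ.≤-pred (Fin.toℕ<n v)))))

encodeColor-injective : ∀ {a b} → encodeColor a ≡ encodeColor b → a ≡ b
encodeColor-injective {nothing}    {nothing}    _ = refl
encodeColor-injective {just false} {just false} _ = refl
encodeColor-injective {just true}  {just true}  _ = refl

size-color : ∀ m → size (encodeColor m) ≤ 5
size-color nothing      = s≤s z≤n
size-color (just false) = s≤s (s≤s (s≤s z≤n))
size-color (just true)  = ℕ.≤-refl

neg-cost and-cost : ℕ → ℕ
neg-cost b = 25 + b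
and-cost b = 40 + b

find-cost : ℕ → ℕ → ℕ
find-cost zero    b = 10 + 0
find-cost (suc m) b = 40 + (b + find-cost m b)

ex-cost : ℕ → ℕ → ℕ
ex-cost n b = 40 + find-cost n b

eval-cost : ∀ {k} → Formula k → ℕ → ℕ
eval-cost {k} (edge _ _)  n = 40 + (k * 7 + n * 7 + k * 7 + n * 7)
eval-cost {k} (equal _ _) n = 40 + (k * 7 + k * 7 + n * 2 * 15)
eval-cost {k} (col _ _)   n = 40 + (k * 7 + n * 7 + 5 * 15)
eval-cost (neg φ) n = neg-cost (eval-cost φ n)
eval-cost (φ ∧ ψ) n = and-cost (eval-cost φ n + eval-cost ψ n)
eval-cost (φ ∨ ψ) n = neg-cost (and-cost (neg-cost (eval-cost φ n) + neg-cost (eval-cost ψ n)))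
eval-cost (φ ⇒ ψ) n = neg-cost (and-cost (eval-cost φ n + neg-cost (eval-cost ψ n)))
eval-cost (ex φ)  n = ex-cost n (eval-cost φ n)
eval-cost (all φ) n = neg-cost (ex-cost n (neg-cost (eval-cost φ n)))

update-cost : ℕ → ℕ → ℕ → ℕ → ℕ
update-cost n zero    a b = 10 + 0
update-cost n (suc m) a b = 50 + (35 + (n * 7 + (a + b)) + update-cost n m a b)

module Eval (rules final : Tree) {n} (G : Graph n) where
  open Graph G
  open Semantics G
  open Program (program rules final)
  open Execution rules final

  adjacency : Tree
  adjacency = encodeList (tabulate λ u → encodeList (tabulate λ v → encodeBool (adj u v)))

  vertices : List (Fin n) → Tree
  vertices vs = encodeList (map ⌜_⌝ vs)

  environment : ∀ {k} → Vector (Fin n) k → Tree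
  environment ρ = encodeList (tabulate (⌜_⌝ ∘ ρ))

  coloring : Coloring n → Tree
  coloring c = encodeList (tabulate (encodeColor ∘ c))

  context : Coloring n → Vec Tree 3
  context c = adjacency ∷ vertices (allFin n) ∷ coloring c ∷ []

  module _ (c : Coloring n) where

    -- Stated for any tree and predicate, so that the derived connectives are assembled from `neg⁺`,
    -- `and⁺` and `ex⁺` while the recursion in `eval⁺` stays structural.
    Evaluates : ∀ {k} → Tree → (Vector (Fin n) k → Set) → ℕ → Set
    Evaluates t R b = ∀ ρ →
      ∃[ v ] (Run (t ∷ environment ρ ∷ context c) (body eval) v 0 b × Verdict (R ρ) v)

    env⁺ : ∀ {k} (ρ : Vector (Fin n) k) i → Run (environment ρ ∷ ⌜ i ⌝ ∷ []) (body nth) ⌜ ρ i ⌝ 0 (k * 7)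
    env⁺ ρ i = nth⁺ (⌜_⌝ ∘ ρ) i

    edge⁺ : ∀ {k} (i j : Fin k) →
      Evaluates (code (edge i j)) (Sat c (edge i j)) (eval-cost (edge i j) n)
    edge⁺ i j ρ = _ ,
      pack 40 ℕ.≤-refl (case-cons⁺ (#⁺ 0) (case-nil⁺ (#⁺ 0) (case-cons⁺ (#⁺ 1)
        (call⁺ nth
          (call⁺ nth
            (var⁺ _ ∷⁺ [ call⁺ nth (var⁺ _ ∷⁺ [ #⁺ 0 ]⁺) (env⁺ ρ i) ]⁺)
            (nth⁺ (λ u → encodeList (tabulate λ v → encodeBool (adj u v))) (ρ i)) ∷⁺
           [ call⁺ nth (var⁺ _ ∷⁺ [ #⁺ 1 ]⁺) (env⁺ ρ j) ]⁺)
          (nth⁺ (λ v → encodeBool (adj (ρ i) v)) (ρ j)))))) ,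
      verdict (adj (ρ i) (ρ j))
      where
      verdict : ∀ b → Verdict (b ≡ true) (encodeBool b)
      verdict false = rejects λ ()
      verdict true  = accepts refl

    equal⁺ : ∀ {k} (i j : Fin k) →
      Evaluates (code (equal i j)) (Sat c (equal i j)) (eval-cost (equal i j) n)
    equal⁺ {k} i j ρ with v , r , d ← same⁺ ⌜ ρ i ⌝ ⌜ ρ j ⌝ = v ,
      pack 40 (ℕ.+-monoʳ-≤ (k * 7 + k * 7) (ℕ.*-monoˡ-≤ 15 (size-⌜⌝ (ρ i))))
        (case-cons⁺ (#⁺ 0) (case-cons⁺ (#⁺ 0) (case-nil⁺ (#⁺ 1) (case-cons⁺ (#⁺ 3)
          (call⁺ same
            (call⁺ nth (var⁺ _ ∷⁺ [ #⁺ 0 ]⁺) (env⁺ ρ i) ∷⁺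
             [ call⁺ nth (var⁺ _ ∷⁺ [ #⁺ 1 ]⁺) (env⁺ ρ j) ]⁺) r))))) ,
      Verdict-map ⌜⌝-injective (cong ⌜_⌝) d

    col⁺ : ∀ {k} m (i : Fin k) →
      Evaluates (code (col m i)) (Sat c (col m i)) (eval-cost (col m i) n)
    col⁺ {k} m i ρ with v , r , d ← same⁺ (encodeColor m) (encodeColor (c (ρ i))) = v ,
      pack 40 (ℕ.+-monoʳ-≤ (k * 7 + n * 7) (ℕ.*-monoˡ-≤ 15 (size-color m)))
        (case-cons⁺ (#⁺ 0) (case-cons⁺ (#⁺ 0) (case-cons⁺ (#⁺ 1) (case-nil⁺ (#⁺ 1) (case-cons⁺ (#⁺ 5)
          (call⁺ same
            (#⁺ 0 ∷⁺ [ call⁺ nth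
              (var⁺ _ ∷⁺ [ call⁺ nth (var⁺ _ ∷⁺ [ #⁺ 1 ]⁺) (env⁺ ρ i) ]⁺)
              (nth⁺ (encodeColor ∘ c) (ρ i)) ]⁺) r)))))) ,
      Verdict-map (sym ∘ encodeColor-injective) (cong encodeColor ∘ sym) d

    module _ {k} {t : Tree} {R : Vector (Fin n) k → Set} {b} (ev : Evaluates t R b) where

      neg⁺ : Evaluates (neg-code t) (λ ρ → ¬ R ρ) (neg-cost b)
      neg⁺ ρ with ev ρ
      ... | _ , r , accepts p = _ , pack 25 (ℕ.≤-reflexive (ℕ.+-identityʳ b))
              (case-cons⁺ (#⁺ 0) (case-cons⁺ (#⁺ 0) (case-cons⁺ (#⁺ 1) (case-cons⁺ (#⁺ 1) (case-nil⁺ (#⁺ 1)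
                (case-cons⁺ (call⁺ eval (var⁺ _ ∷⁺ var⁺ _ ∷⁺ var⁺ _ ∷⁺ var⁺ _ ∷⁺ [ var⁺ _ ]⁺) r) nil⁺)))))) ,
              rejects λ ¬p → ¬p p
      ... | _ , r , rejects ¬p = _ , pack 25 (ℕ.≤-reflexive (ℕ.+-identityʳ b))
              (case-cons⁺ (#⁺ 0) (case-cons⁺ (#⁺ 0) (case-cons⁺ (#⁺ 1) (case-cons⁺ (#⁺ 1) (case-nil⁺ (#⁺ 1)
                (case-nil⁺ (call⁺ eval (var⁺ _ ∷⁺ var⁺ _ ∷⁺ var⁺ _ ∷⁺ var⁺ _ ∷⁺ [ var⁺ _ ]⁺) r) truth⁺)))))) ,
              accepts ¬p

      and⁺ : ∀ {s} {S : Vector (Fin n) k → Set} {a} → Evaluates s S a →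
        Evaluates (and-code t s) (λ ρ → R ρ × S ρ) (and-cost (b + a))
      and⁺ {a = a} ev′ ρ with ev ρ
      ... | _ , r , rejects ¬p = _ , pack 40 (ℕ.+-monoʳ-≤ b z≤n)
              (case-cons⁺ (#⁺ 0) (case-cons⁺ (#⁺ 0) (case-cons⁺ (#⁺ 1) (case-cons⁺ (#⁺ 1) (case-cons⁺ (#⁺ 1) (case-nil⁺ (#⁺ 1)
                (case-cons⁺ (#⁺ 9) (case-nil⁺ (call⁺ eval (#⁺ 0 ∷⁺ var⁺ _ ∷⁺ var⁺ _ ∷⁺ var⁺ _ ∷⁺ [ var⁺ _ ]⁺) r) nil⁺)))))))) ,
              rejects (¬p ∘ proj₁)
      ... | _ , r , accepts p with ev′ ρ
      ...   | v , r′ , d = v , pack 40 ℕ.≤-refl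
              (case-cons⁺ (#⁺ 0) (case-cons⁺ (#⁺ 0) (case-cons⁺ (#⁺ 1) (case-cons⁺ (#⁺ 1) (case-cons⁺ (#⁺ 1) (case-nil⁺ (#⁺ 1)
                (case-cons⁺ (#⁺ 9) (case-cons⁺ (call⁺ eval (#⁺ 0 ∷⁺ var⁺ _ ∷⁺ var⁺ _ ∷⁺ var⁺ _ ∷⁺ [ var⁺ _ ]⁺) r)
                  (call⁺ eval (#⁺ 3 ∷⁺ var⁺ _ ∷⁺ var⁺ _ ∷⁺ var⁺ _ ∷⁺ [ var⁺ _ ]⁺) r′))))))))) ,
              Verdict-map (p ,_) proj₂ d

    data Found (R : Fin n → Set) (vs : List (Fin n)) : Tree → Set where
      none : (∀ {v} → v ∈ vs → ¬ R v) → Found R vs nil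
      some : ∀ v → R v → Found R vs (cons ⌜ v ⌝ nil)

    find⁺ : ∀ {k} {t : Tree} {R : Vector (Fin n) (suc k) → Set} {b} → Evaluates t R b →
      ∀ ρ vs → ∃[ v ] (Run (vertices vs ∷ t ∷ environment ρ ∷ context c) (body find) v 0 (find-cost (length vs) b)
                       × Found (λ w → R (w ▸ ρ)) vs v)
    find⁺ ev ρ []       = _ , pack 10 z≤n (case-nil⁺ (#⁺ 0) nil⁺) , none λ ()
    find⁺ {b = b} ev ρ (v ∷ vs) with ev (v ▸ ρ)
    ... | _ , r , accepts p = _ , pack 40 (ℕ.+-monoʳ-≤ b z≤n)
            (case-cons⁺ (#⁺ 0) (case-cons⁺
              (call⁺ eval (#⁺ 3 ∷⁺ cons⁺ (#⁺ 0) (#⁺ 4) ∷⁺ #⁺ 5 ∷⁺ #⁺ 6 ∷⁺ [ #⁺ 7 ]⁺) r)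
              (cons⁺ (#⁺ 2) nil⁺))) ,
            some v p
    ... | _ , r , rejects ¬p with find⁺ ev ρ vs
    ...   | x , r′ , found = x , pack 40 ℕ.≤-refl
            (case-cons⁺ (#⁺ 0) (case-nil⁺
              (call⁺ eval (#⁺ 3 ∷⁺ cons⁺ (#⁺ 0) (#⁺ 4) ∷⁺ #⁺ 5 ∷⁺ #⁺ 6 ∷⁺ [ #⁺ 7 ]⁺) r)
              (call⁺ find (#⁺ 1 ∷⁺ #⁺ 3 ∷⁺ #⁺ 4 ∷⁺ #⁺ 5 ∷⁺ #⁺ 6 ∷⁺ [ #⁺ 7 ]⁺) r′))) ,
            weaken found
      where
      weaken : ∀ {x} → Found _ vs x → Found _ (v ∷ vs) x
      weaken (none h)   = none λ { (here refl) → ¬p ; (there w∈) → h w∈ }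
      weaken (some w q) = some w q

    find-all⁺ : ∀ {k} {t : Tree} {R : Vector (Fin n) (suc k) → Set} {b} → Evaluates t R b →
      ∀ ρ → ∃[ v ] (Run (vertices (allFin n) ∷ t ∷ environment ρ ∷ context c) (body find) v 0 (find-cost n b)
                    × Found (λ w → R (w ▸ ρ)) (allFin n) v)
    find-all⁺ {b = b} ev ρ with v , r , f ← find⁺ ev ρ (allFin n) =
      v , relax (ℕ.≤-reflexive (cong (λ m → find-cost m b) (length-tabulate {n = n} id))) r , f

    ex⁺ : ∀ {k} {t : Tree} {R : Vector (Fin n) (suc k) → Set} {b} → Evaluates t R b →
      Evaluates (ex-code t) (λ ρ → ∃[ v ] R (v ▸ ρ)) (ex-cost n b)
    ex⁺ ev ρ with v , r , f ← find-all⁺ ev ρ = v , pack 40 ℕ.≤-refl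
      (case-cons⁺ (#⁺ 0) (case-cons⁺ (#⁺ 0) (case-cons⁺ (#⁺ 1) (case-cons⁺ (#⁺ 1) (case-cons⁺ (#⁺ 1) (case-cons⁺ (#⁺ 1)
        (call⁺ find (var⁺ _ ∷⁺ var⁺ _ ∷⁺ var⁺ _ ∷⁺ var⁺ _ ∷⁺ var⁺ _ ∷⁺ [ var⁺ _ ]⁺) r))))))) ,
      verdict f
      where
      verdict : ∀ {v R} → Found R (allFin n) v → Verdict (∃ R) v
      verdict (none h)   = rejects λ (v , p) → h (∈-allFin v) p
      verdict (some v p) = accepts (v , p)

    Evaluates-map : ∀ {k t b} {R S : Vector (Fin n) k → Set} →
      (∀ ρ → R ρ → S ρ) → (∀ ρ → S ρ → R ρ) → Evaluates t R b → Evaluates t S b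
    Evaluates-map f g ev ρ with v , r , d ← ev ρ = v , r , Verdict-map (f ρ) (g ρ) d

    eval⁺ : ∀ {k} (φ : Formula k) → Evaluates (code φ) (Sat c φ) (eval-cost φ n)
    eval⁺ (edge i j)  = edge⁺ i j
    eval⁺ (equal i j) = equal⁺ i j
    eval⁺ (col m i)   = col⁺ m i
    eval⁺ (neg φ)     = neg⁺ (eval⁺ φ)
    eval⁺ (φ ∧ ψ)     = and⁺ (eval⁺ φ) (eval⁺ ψ)
    eval⁺ (φ ∨ ψ)     = Evaluates-map
      (λ ρ ¬¬ → decidable-stable (sat? c (φ ∨ ψ) ρ) λ ¬∨ → ¬¬ (¬∨ ∘ inj₁ , ¬∨ ∘ inj₂))
      (λ ρ p (¬φ , ¬ψ) → [ ¬φ , ¬ψ ]′ p)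
      (neg⁺ (and⁺ (neg⁺ (eval⁺ φ)) (neg⁺ (eval⁺ ψ))))
    eval⁺ (φ ⇒ ψ)     = Evaluates-map
      (λ ρ h p → decidable-stable (sat? c ψ ρ) λ ¬q → h (p , ¬q))
      (λ ρ f (p , ¬q) → ¬q (f p))
      (neg⁺ (and⁺ (eval⁺ φ) (neg⁺ (eval⁺ ψ))))
    eval⁺ (ex φ)      = ex⁺ (eval⁺ φ)
    eval⁺ (all φ)     = Evaluates-map
      (λ ρ h v → decidable-stable (sat? c φ (v ▸ ρ)) λ ¬p → h (v , ¬p))
      (λ ρ h (v , ¬p) → ¬p (h v))
      (neg⁺ (ex⁺ (neg⁺ (eval⁺ φ))))

-- Correctness and cost of the search tree

rule-update-cost : Rule → ℕ → ℕ
rule-update-cost r n = update-cost n n (eval-cost (to true) n) (eval-cost (to false) n)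
  where open Rule r

search-cost : Rule → ℕ → ℕ → ℕ
search-cost r n zero    = 10 + 0
search-cost r n (suc m) =
  100 + (eval-cost (Rule.branch r) n + rule-update-cost r n + search-cost r n m)

try-cost : Formula 0 → List Rule → ℕ → ℕ
try-cost final []       n = 60 + (size (code final) + eval-cost final n)
try-cost final (r ∷ rs) n =
  60 + (find-cost n (eval-cost (Rule.guard r) n) + (search-cost r n n + try-cost final rs n))

solve-cost : Formula 0 → List Rule → ℕ → ℕ
solve-cost final rules n = 60 + (size (encodeList (map rule-code rules)) + try-cost final rules n)

module Engine (P Q : ℕ) .{{_ : NonZero P}} (Q≤P : Q ≤ P)
  (rate₃₃ : 2 * Q ^ 3 ≤ P ^ 3) (rate₂₄ : Q ^ 2 * P ^ 2 + Q ^ 4 ≤ P ^ 4)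
  (rate-many : ∀ d → d * Q ^ (2 + d) ≤ P ^ (2 + d))
  (rules : List Rule) (final : Formula 0) {n} (G : Graph n) where

  open Rates P Q Q≤P rate₃₃ rate₂₄ rate-many
  open Semantics G
  open Program (program (encodeList (map rule-code rules)) (code final))
  open Evaluation (program (encodeList (map rule-code rules)) (code final))
  open Execution (encodeList (map rule-code rules)) (code final)

  private
    module Ev = Eval (encodeList (map rule-code rules)) (code final) G
    rate-cost : Coloring n → Rule → Fin n → Fin n → ℕ
    rate-cost = cost G
    S = solve-cost final rules n
  open Ev

  module _ (c : Coloring n) (r : Rule) (p w : Fin n) where
    open Rule r

    private
      toA = eval-cost (to true) n
      toB = eval-cost (to false) n
      ρ = w ▸ p ▸ ⟨⟩

    update-one⁺ : ∀ u {s t} →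
      Run (⌜ u ⌝ ∷ s ∷ t ∷ code (to true) ∷ code (to false) ∷ environment ρ ∷ context c)
        update-one (encodeColor (recolor c r p w u)) 0 (35 + (n * 7 + (toA + toB)))
    update-one⁺ u with c u | call⁺ nth (#⁺ 8 ∷⁺ [ #⁺ 0 ]⁺) (nth⁺ (encodeColor ∘ c) u)
    ... | just b  | r = pack 35 (ℕ.+-monoʳ-≤ (n * 7) z≤n) (case-cons⁺ r (cons⁺ (#⁺ 0) (#⁺ 1)))
    ... | nothing | r with sat? c (to true) (u ▸ ρ) | eval⁺ c (to true) (u ▸ ρ)
    ...   | yes _ | _ , r′ , accepts _ = pack 35 (ℕ.+-monoʳ-≤ (n * 7) (ℕ.+-monoʳ-≤ toA z≤n))
              (case-nil⁺ r (case-cons⁺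
                (call⁺ eval (#⁺ 3 ∷⁺ cons⁺ (#⁺ 0) (#⁺ 5) ∷⁺ #⁺ 6 ∷⁺ #⁺ 7 ∷⁺ [ #⁺ 8 ]⁺) r′)
                (cons⁺ truth⁺ nil⁺)))
    ...   | yes h | _ , _ , rejects ¬h = contradiction h ¬h
    ...   | no ¬h | _ , _ , accepts h = contradiction h ¬h
    ...   | no _  | _ , r′ , rejects _ with sat? c (to false) (u ▸ ρ) | eval⁺ c (to false) (u ▸ ρ)
    ...     | yes _ | _ , r″ , accepts _ = pack 35
                (ℕ.+-monoʳ-≤ (n * 7) (ℕ.+-monoʳ-≤ toA (ℕ.≤-reflexive (ℕ.+-identityʳ toB))))
                (case-nil⁺ r (case-nil⁺
                  (call⁺ eval (#⁺ 3 ∷⁺ cons⁺ (#⁺ 0) (#⁺ 5) ∷⁺ #⁺ 6 ∷⁺ #⁺ 7 ∷⁺ [ #⁺ 8 ]⁺) r′)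
                  (case-cons⁺
                    (call⁺ eval (#⁺ 4 ∷⁺ cons⁺ (#⁺ 0) (#⁺ 5) ∷⁺ #⁺ 6 ∷⁺ #⁺ 7 ∷⁺ [ #⁺ 8 ]⁺) r″)
                    (cons⁺ nil⁺ nil⁺))))
    ...     | yes h | _ , _ , rejects ¬h = contradiction h ¬h
    ...     | no ¬h | _ , _ , accepts h = contradiction h ¬h
    ...     | no _  | _ , r″ , rejects _ = pack 35
                (ℕ.+-monoʳ-≤ (n * 7) (ℕ.+-monoʳ-≤ toA (ℕ.≤-reflexive (ℕ.+-identityʳ toB))))
                (case-nil⁺ r (case-nil⁺
                  (call⁺ eval (#⁺ 3 ∷⁺ cons⁺ (#⁺ 0) (#⁺ 5) ∷⁺ #⁺ 6 ∷⁺ #⁺ 7 ∷⁺ [ #⁺ 8 ]⁺) r′)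
                  (case-nil⁺
                    (call⁺ eval (#⁺ 4 ∷⁺ cons⁺ (#⁺ 0) (#⁺ 5) ∷⁺ #⁺ 6 ∷⁺ #⁺ 7 ∷⁺ [ #⁺ 8 ]⁺) r″)
                    nil⁺)))

    update⁺ : ∀ us →
      Run (vertices us ∷ code (to true) ∷ code (to false) ∷ environment ρ ∷ context c)
        (body update) (encodeList (map (encodeColor ∘ recolor c r p w) us)) 0 (update-cost n (length us) toA toB)
    update⁺ []       = pack 10 z≤n (case-nil⁺ (#⁺ 0) nil⁺)
    update⁺ (u ∷ us) = pack 50 ℕ.≤-refl (case-cons⁺ (#⁺ 0) (cons⁺ (update-one⁺ u)
      (call⁺ update (#⁺ 1 ∷⁺ #⁺ 3 ∷⁺ #⁺ 4 ∷⁺ #⁺ 5 ∷⁺ #⁺ 6 ∷⁺ #⁺ 7 ∷⁺ [ #⁺ 8 ]⁺) (update⁺ us))))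

    update-all⁺ :
      Run (vertices (allFin n) ∷ code (to true) ∷ code (to false) ∷ environment ρ ∷ context c)
        (body update) (coloring (recolor c r p w)) 0 (rule-update-cost r n)
    update-all⁺ = relax (ℕ.≤-reflexive (cong (λ m → update-cost n m toA toB) (length-tabulate {n = n} id)))
      (subst
        (λ v → Run (vertices (allFin n) ∷ code (to true) ∷ code (to false) ∷ environment ρ ∷ context c)
          (body update) v 0 (update-cost n (length (allFin n)) toA toB))
        (cong encodeList (map-tabulate id (encodeColor ∘ recolor c r p w))) (update⁺ (allFin n)))

  -- After scaling, a call without its recursive calls costs at most `S * P ^ u`. The recursive
  -- calls cost at most `u` times as much, since the weights of the branches sum to at most `P ^ u`.
  -- The factor `suc u` thus accounts for the depth of the recursion.
  record SolveRun (c : Coloring n) : Set where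
    constructor solved
    field
      {value}    : Tree
      {steps}    : ℕ
      derivation : context c ⊢ body solve ⇓ value ∣ steps
      time       : steps * Q ^ #unc c ≤ suc (#unc c) * (S * P ^ #unc c)
      verdict    : Verdict (Solvable c) value

  module _ {c : Coloring n} (recurse : ∀ {c′} → #unc c′ < #unc c → SolveRun c′) where

    private
      u = #unc c

    module _ (r : Rule) (p : Fin n)
      (decreasing : ∀ w → Sat c (Rule.branch r) (w ▸ p ▸ ⟨⟩) → #unc (recolor c r p w) < u) where
      open Rule r

      private
        branch? : (w : Fin n) → Dec (Sat c branch (w ▸ p ▸ ⟨⟩))
        branch? w = sat? c branch (w ▸ p ▸ ⟨⟩)

      Succeeds : List (Fin n) → Set
      Succeeds ws = ∃[ w ] (w ∈ ws × Sat c branch (w ▸ p ▸ ⟨⟩) × Solvable (recolor c r p w))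

      -- extra is the time spent in recursive calls of solve.
      record SearchRun (ws : List (Fin n)) : Set where
        constructor searched
        field
          {value}    : Tree
          extra      : ℕ
          derivation : Run (vertices ws ∷ cons (code branch) (cons (code (to true)) (code (to false))) ∷ ⌜ p ⌝ ∷ context c)
                         (body search) value 0 (search-cost r n (length ws) + extra)
          time       : extra * Q ^ u ≤ u * S * sum (map (rate-cost c r p) (filter branch? ws))
          verdict    : Verdict (Succeeds ws) value

      -- From `suc u′ ≤ u`, the factor of the smaller instance is at most `u`, which leaves one `S`
      -- for the work of the present call.
      recursion-time : ∀ {u′ t} → u′ < u → t * Q ^ u′ ≤ suc u′ * (S * P ^ u′) →
        t * Q ^ u ≤ u * S * weight u u′
      recursion-time {u′} {t} u′<u t≤ = begin
        t * Q ^ u                              ≡⟨ cong (λ e → t * Q ^ e) (ℕ.m+[n∸m]≡n (ℕ.<⇒≤ u′<u)) ⟨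
        t * Q ^ (u′ + (u ∸ u′))                ≡⟨ cong (t *_) (ℕ.^-distribˡ-+-* Q u′ (u ∸ u′)) ⟩
        t * (Q ^ u′ * Q ^ (u ∸ u′))            ≡⟨ ℕ.*-assoc t _ _ ⟨
        t * Q ^ u′ * Q ^ (u ∸ u′)              ≤⟨ ℕ.*-monoˡ-≤ (Q ^ (u ∸ u′)) t≤ ⟩
        suc u′ * (S * P ^ u′) * Q ^ (u ∸ u′)   ≤⟨ ℕ.*-monoˡ-≤ (Q ^ (u ∸ u′)) (ℕ.*-monoˡ-≤ (S * P ^ u′) u′<u) ⟩
        u * (S * P ^ u′) * Q ^ (u ∸ u′)        ≡⟨ shuffle u S (P ^ u′) (Q ^ (u ∸ u′)) ⟩
        u * S * (P ^ u′ * Q ^ (u ∸ u′))        ∎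
        where
        open ℕ.≤-Reasoning
        shuffle : ∀ a b d e → a * (b * d) * e ≡ a * b * (d * e)
        shuffle = solve-∀

      search⁺ : ∀ ws → SearchRun ws
      search⁺ []       = searched 0 (pack 10 z≤n (case-nil⁺ (#⁺ 0) nil⁺)) z≤n (rejects λ ())
      search⁺ (w ∷ ws) with eval⁺ c branch (w ▸ p ▸ ⟨⟩)
      ... | _ , e , rejects ¬b with searched x r′ t d ← search⁺ ws = searched x
              (pack 100 (slack (eval-cost branch n) (rule-update-cost r n) (search-cost r n (length ws)) x)
                (case-cons⁺ (#⁺ 0) (case-cons⁺ (#⁺ 3) (case-cons⁺ (#⁺ 1) (case-nil⁺
                  (call⁺ eval (#⁺ 2 ∷⁺ cons⁺ (#⁺ 4) (cons⁺ (#⁺ 8) nil⁺) ∷⁺ #⁺ 9 ∷⁺ #⁺ 10 ∷⁺ [ #⁺ 11 ]⁺) e)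
                  (call⁺ search (#⁺ 5 ∷⁺ #⁺ 7 ∷⁺ #⁺ 8 ∷⁺ #⁺ 9 ∷⁺ #⁺ 10 ∷⁺ [ #⁺ 11 ]⁺) r′))))))
              (subst (λ l → x * Q ^ u ≤ u * S * sum (map (rate-cost c r p) l)) (sym (filter-reject branch? ¬b)) t)
              (Verdict-map (λ (v , v∈ , h) → v , there v∈ , h)
                (λ { (v , here refl , b , _) → contradiction b ¬b ; (v , there v∈ , h) → v , v∈ , h }) d)
        where
        slack : ∀ a b s x → a + (s + x) ≤ a + b + s + x
        slack a b s x = ℕ.≤-trans (ℕ.m≤m+n _ b) (ℕ.≤-reflexive (eq a b s x))
          where
          eq : ∀ a b s x → a + (s + x) + b ≡ a + b + s + x
          eq = solve-∀
      ... | _ , e , accepts b with recurse (decreasing w b)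
      ...   | solved {steps = t} s time (accepts sv) = searched t
              (pack 100 (slack (eval-cost branch n) (rule-update-cost r n) (search-cost r n (length ws)) t)
                (case-cons⁺ (#⁺ 0) (case-cons⁺ (#⁺ 3) (case-cons⁺ (#⁺ 1) (case-cons⁺
                  (call⁺ eval (#⁺ 2 ∷⁺ cons⁺ (#⁺ 4) (cons⁺ (#⁺ 8) nil⁺) ∷⁺ #⁺ 9 ∷⁺ #⁺ 10 ∷⁺ [ #⁺ 11 ]⁺) e)
                  (case-cons⁺
                    (call⁺ solve (#⁺ 11 ∷⁺ #⁺ 12 ∷⁺ [ call⁺ update
                      (#⁺ 12 ∷⁺ #⁺ 2 ∷⁺ #⁺ 3 ∷⁺ cons⁺ (#⁺ 6) (cons⁺ (#⁺ 10) nil⁺) ∷⁺ #⁺ 11 ∷⁺ #⁺ 12 ∷⁺ [ #⁺ 13 ]⁺)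
                      (update-all⁺ c r p w) ]⁺) (run s ℕ.≤-refl))
                    truth⁺))))))
              -- Success ends the search early; the weights of the untried branches only enlarge the
              -- bound.
              (subst (λ l → t * Q ^ u ≤ u * S * sum (map (rate-cost c r p) l)) (sym (filter-accept branch? b))
                (ℕ.≤-trans (recursion-time {t = t} (decreasing w b) time) (ℕ.*-monoʳ-≤ (u * S) (ℕ.m≤m+n _ _))))
              (accepts (w , here refl , b , sv))
        where
        slack : ∀ a b s x → a + (b + x + 0) ≤ a + b + s + x
        slack a b s x = ℕ.≤-trans (ℕ.m≤m+n _ s) (ℕ.≤-reflexive (eq a b s x))
          where
          eq : ∀ a b s x → a + (b + x + 0) + s ≡ a + b + s + x
          eq = solve-∀
      ...   | solved {steps = t} s time (rejects ¬sv) with searched x r′ t′ d ← search⁺ ws = searched (t + x)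
              (pack 100 (ℕ.≤-reflexive (rearrange (eval-cost branch n) (rule-update-cost r n) (search-cost r n (length ws)) t x))
                (case-cons⁺ (#⁺ 0) (case-cons⁺ (#⁺ 3) (case-cons⁺ (#⁺ 1) (case-cons⁺
                  (call⁺ eval (#⁺ 2 ∷⁺ cons⁺ (#⁺ 4) (cons⁺ (#⁺ 8) nil⁺) ∷⁺ #⁺ 9 ∷⁺ #⁺ 10 ∷⁺ [ #⁺ 11 ]⁺) e)
                  (case-nil⁺
                    (call⁺ solve (#⁺ 11 ∷⁺ #⁺ 12 ∷⁺ [ call⁺ update
                      (#⁺ 12 ∷⁺ #⁺ 2 ∷⁺ #⁺ 3 ∷⁺ cons⁺ (#⁺ 6) (cons⁺ (#⁺ 10) nil⁺) ∷⁺ #⁺ 11 ∷⁺ #⁺ 12 ∷⁺ [ #⁺ 13 ]⁺)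
                      (update-all⁺ c r p w) ]⁺) (run s ℕ.≤-refl))
                    (call⁺ search (#⁺ 7 ∷⁺ #⁺ 9 ∷⁺ #⁺ 10 ∷⁺ #⁺ 11 ∷⁺ #⁺ 12 ∷⁺ [ #⁺ 13 ]⁺) r′)))))))
              (subst (λ l → (t + x) * Q ^ u ≤ u * S * sum (map (rate-cost c r p) l)) (sym (filter-accept branch? b))
                total)
              (Verdict-map (λ (v , v∈ , h) → v , there v∈ , h)
                (λ { (v , here refl , _ , sv) → contradiction sv ¬sv ; (v , there v∈ , h) → v , v∈ , h }) d)
        where
        rearrange : ∀ a b s t x → a + (b + t + (s + x)) ≡ a + b + s + (t + x)
        rearrange = solve-∀
        f = rate-cost c r p
        open ℕ.≤-Reasoning
        total : (t + x) * Q ^ u ≤ u * S * (f w + sum (map f (filter branch? ws)))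
        total = begin
          (t + x) * Q ^ u                                       ≡⟨ ℕ.*-distribʳ-+ (Q ^ u) t x ⟩
          t * Q ^ u + x * Q ^ u                                 ≤⟨ ℕ.+-mono-≤ (recursion-time {t = t} (decreasing w b) time) t′ ⟩
          u * S * f w + u * S * sum (map f (filter branch? ws)) ≡⟨ ℕ.*-distribˡ-+ (u * S) (f w) _ ⟨
          u * S * (f w + sum (map f (filter branch? ws)))       ∎

    record TryRun (rs : List Rule) : Set where
      constructor tried
      field
        {value}    : Tree
        extra      : ℕ
        derivation : Run (encodeList (map rule-code rs) ∷ context c) (body try) value 0 (try-cost final rs n + extra)
        time       : extra * Q ^ u ≤ u * S * P ^ u
        verdict    : Verdict (Solvable c) value

    -- The later rules are analysed only under the assumption that this one is inapplicable; their
    -- validity proofs depend on that.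
    try-rule⁺ : ∀ {r rs} → (∀ p → Sat c (Rule.guard r) (p ▸ ⟨⟩) → Valid G c r p) →
      (Inapplicable G {c} r → TryRun rs) → TryRun (r ∷ rs)
    try-rule⁺ {r} {rs} valid rest with find-all⁺ c (eval⁺ c (Rule.guard r)) ⟨⟩
    ... | _ , e , none ¬g with tried x r′ t d ← rest (λ p → ¬g (∈-allFin p)) = tried x
            (pack 60 (slack (find-cost n (eval-cost (Rule.guard r) n)) (search-cost r n n) (try-cost final rs n) x)
              (case-cons⁺ (#⁺ 0) (case-cons⁺ (#⁺ 0) (case-nil⁺
                (call⁺ find (#⁺ 6 ∷⁺ #⁺ 0 ∷⁺ nil⁺ ∷⁺ #⁺ 5 ∷⁺ #⁺ 6 ∷⁺ [ #⁺ 7 ]⁺) e)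
                (call⁺ try (#⁺ 3 ∷⁺ #⁺ 5 ∷⁺ #⁺ 6 ∷⁺ [ #⁺ 7 ]⁺) r′)))))
            t d
      where
      slack : ∀ a b s x → a + (s + x) ≤ a + (b + s) + x
      slack a b s x = ℕ.≤-trans (ℕ.m≤m+n _ b) (ℕ.≤-reflexive (eq a b s x))
        where
        eq : ∀ a b s x → a + (s + x) + b ≡ a + (b + s) + x
        eq = solve-∀
    ... | _ , e , some p g
      with searched x r′ t d ← search⁺ r p (Valid.decreasing (valid p g)) (allFin n) = tried x
            (pack 60 (ℕ.≤-trans
                (ℕ.≤-reflexive (cong (λ m → find-cost n (eval-cost (Rule.guard r) n) + (search-cost r n m + x))
                  (length-tabulate {n = n} id)))
                (slack (find-cost n (eval-cost (Rule.guard r) n)) (search-cost r n n) (try-cost final rs n) x))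
              (case-cons⁺ (#⁺ 0) (case-cons⁺ (#⁺ 0) (case-cons⁺
                (call⁺ find (#⁺ 6 ∷⁺ #⁺ 0 ∷⁺ nil⁺ ∷⁺ #⁺ 5 ∷⁺ #⁺ 6 ∷⁺ [ #⁺ 7 ]⁺) e)
                (call⁺ search (#⁺ 8 ∷⁺ #⁺ 3 ∷⁺ #⁺ 0 ∷⁺ #⁺ 7 ∷⁺ #⁺ 8 ∷⁺ [ #⁺ 9 ]⁺) r′)))))
            (ℕ.≤-trans t (ℕ.*-monoʳ-≤ (u * S) (Valid.affordable (valid p g))))
            (Verdict-map
              -- Recolouring only adds colours, so success in any branch is success for `c`.
              (λ { (w , _ , _ , s , sol , ext) → s , sol , recolor-unextends {r = r} ext })
              (λ sv → let w , b , sv′ = Valid.complete (valid p g) sv in w , ∈-allFin w , b , sv′) d)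
      where
      slack : ∀ a b s x → a + (b + x) ≤ a + (b + s) + x
      slack a b s x = ℕ.≤-trans (ℕ.m≤m+n _ s) (ℕ.≤-reflexive (eq a b s x))
        where
        eq : ∀ a b s x → a + (b + x) + s ≡ a + (b + s) + x
        eq = solve-∀

    try-final⁺ : (Sat c final ⟨⟩ → Solvable c) → (Solvable c → Sat c final ⟨⟩) → TryRun []
    try-final⁺ sound complete with v , r , d ← eval⁺ c final ⟨⟩ = tried 0
      (pack 60 (ℕ.≤-reflexive (rearrange (size (code final)) (eval-cost final n)))
        (case-nil⁺ (#⁺ 0) (call⁺ eval (quoted⁺ (code final) ∷⁺ nil⁺ ∷⁺ #⁺ 1 ∷⁺ #⁺ 2 ∷⁺ [ #⁺ 3 ]⁺) r)))
      z≤n (Verdict-map sound complete d)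
      where
      rearrange : ∀ a b → a + 0 + b ≡ a + b + 0
      rearrange = solve-∀

    private
      rearrange : ∀ a b x → a + 0 + (b + x) ≡ a + b + x
      rearrange = solve-∀

    solve-run : TryRun rules → SolveRun c
    solve-run (tried x r t d)
      with run {s} s⇓ s≤ ← pack 60
        (ℕ.≤-reflexive (rearrange (size (encodeList (map rule-code rules))) (try-cost final rules n) x)) (call⁺ try
        (quoted⁺ {ρ = context c} (encodeList (map rule-code rules)) ∷⁺ #⁺ 0 ∷⁺ #⁺ 1 ∷⁺ [ #⁺ 2 ]⁺) r) = solved s⇓ time d
      where
      open ℕ.≤-Reasoning
      time : s * Q ^ u ≤ suc u * (S * P ^ u)
      time = begin
        s * Q ^ u                     ≤⟨ ℕ.*-monoˡ-≤ (Q ^ u) s≤ ⟩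
        (S + x) * Q ^ u               ≡⟨ ℕ.*-distribʳ-+ (Q ^ u) S x ⟩
        S * Q ^ u + x * Q ^ u         ≤⟨ ℕ.+-mono-≤ (ℕ.*-monoʳ-≤ S (ℕ.^-monoˡ-≤ u Q≤P)) t ⟩
        S * P ^ u + u * S * P ^ u     ≡⟨ cong (S * P ^ u +_) (ℕ.*-assoc u S _) ⟩
        suc u * (S * P ^ u)           ∎

-- The final test on complete colourings

differ : ∀ {k} → Fin k → Fin k → Formula k
differ i j = (col (just true) i ∧ col (just false) j) ∨ (col (just false) i ∧ col (just true) j)

-- Evaluated only when `fresh` is inapplicable: every vertex is then coloured, and the colouring
-- itself is the sole candidate for a solution.
perfect : Formula 0
perfect = all (ex (edge 1F 0F ∧ differ 0F 1F ∧ all (edge 2F 0F ⇒ differ 0F 2F ⇒ equal 0F 1F)))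

module _ {n} (G : Graph n) {c : Coloring n} (colored : ∀ u → ∃[ b ] c u ≡ just b) where
  open Graph G
  open Semantics G

  private
    colors : Fin n → Bool
    colors u = proj₁ (colored u)

    differ-sound : ∀ {u w} → Sat c (differ 0F 1F) (w ▸ u ▸ ⟨⟩) → colors w ≡ not (colors u)
    differ-sound {u} {w} d with colored u | colored w
    differ-sound (inj₁ (cw , cu)) | a , ca | b , cb with refl ← trans (sym cw) cb | refl ← trans (sym cu) ca = refl
    differ-sound (inj₂ (cw , cu)) | a , ca | b , cb with refl ← trans (sym cw) cb | refl ← trans (sym cu) ca = refl

    differ-complete : ∀ {u w} a → c u ≡ just a → c w ≡ just (not a) → Sat c (differ 0F 1F) (w ▸ u ▸ ⟨⟩)
    differ-complete true  cu cw = inj₂ (cw , cu)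
    differ-complete false cu cw = inj₁ (cw , cu)

  perfect-sound : Sat c perfect ⟨⟩ → Solvable c
  perfect-sound h = colors , sol , λ {u} cu → Maybe.just-injective (trans (sym (proj₂ (colored u))) cu)
    where
    sol : IsSolution colors
    sol = record
      { partner  = λ u → proj₁ (h u)
      ; adjacent = λ u → proj₁ (proj₂ (h u))
      ; opposite = λ u → differ-sound {u} {proj₁ (h u)} (proj₁ (proj₂ (proj₂ (h u))))
      ; unique   = λ {u} {w} uw sw → proj₂ (proj₂ (proj₂ (h u))) w uw
          (differ-complete {u} {w} (colors u) (proj₂ (colored u)) (trans (proj₂ (colored w)) (cong just sw)))
      }

  perfect-complete : Solvable c → Sat c perfect ⟨⟩
  perfect-complete (s , sol , ext) u = partner u , adjacent u ,
    differ-complete {u} {partner u} (s u) (at u) (trans (at (partner u)) (cong just (opposite u))) ,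
    λ w uw d → unique uw (trans (agree w) (trans (differ-sound {u} {w} d) (cong not (sym (agree u)))))
    where
    open IsSolution sol
    agree : ∀ u → s u ≡ colors u
    agree u = ext (proj₂ (colored u))
    at : ∀ u → c u ≡ just (s u)
    at u = trans (proj₂ (colored u)) (cong just (sym (agree u)))

rules : List Rule
rules = paint true (forcing true) ∷ paint false (forcing false) ∷
        at-two ∷ at-mixed ∷ at-many ∷ fresh ∷ []

algorithm : Program
algorithm = program (encodeList (map rule-code rules)) (code perfect)

module _ (P Q : ℕ) .{{_ : NonZero P}} (Q≤P : Q ≤ P)
  (rate₃₃ : 2 * Q ^ 3 ≤ P ^ 3) (rate₂₄ : Q ^ 2 * P ^ 2 + Q ^ 4 ≤ P ^ 4)
  (rate-many : ∀ d → d * Q ^ (2 + d) ≤ P ^ (2 + d)) {n} (G : Graph n) where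
  open Engine P Q Q≤P rate₃₃ rate₂₄ rate-many rules perfect G
  open Rates P Q Q≤P rate₃₃ rate₂₄ rate-many
  open Semantics G

  solve⁺ : ∀ c → SolveRun c
  solve⁺ c = go c (<-wellFounded (#unc c))
    where
    go : ∀ c → Acc _<_ (#unc c) → SolveRun c
    go c (acc rs) = solve-run recurse
      (try-rule⁺ recurse (forcing-valid G true) λ ¬true →
       try-rule⁺ recurse (forcing-valid G false) λ ¬false →
       let unforced : ∀ b → Inapplicable G {c} (paint b (forcing b))
           unforced = λ { true → ¬true ; false → ¬false }
       in
       try-rule⁺ recurse (at-two-valid G unforced) λ ¬two →
       try-rule⁺ recurse (at-mixed-valid G unforced ¬two) λ ¬mixed →
       try-rule⁺ recurse (at-many-valid G unforced ¬two ¬mixed) λ ¬many →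
       try-rule⁺ recurse (fresh-valid G ¬many) λ ¬fresh →
       let all-colored : ∀ u → ∃[ b ] c u ≡ just b
           all-colored u = colored G {c} λ cu → ¬fresh u (cu , refl)
       in
       try-final⁺ recurse (perfect-sound G all-colored) (perfect-complete G all-colored))
      where
      recurse : ∀ {c′} → #unc c′ < #unc c → SolveRun c′
      recurse {c′} lt = go c′ (rs lt)

-- Perfect matching cuts as two-colourings

module _ {n} (G : Graph n) where
  open Graph G
  open Semantics G

  encode-adjacency : ∀ {rules final} → encode G ≡ Eval.adjacency rules final G
  encode-adjacency = cong encodeList (trans
    (map-cong (λ u → cong encodeList (map-tabulate id (λ v → encodeBool (adj u v)))) (allFin n))
    (map-tabulate id _))

  cut⇒solution : HasPerfectMatchingCut G → ∃[ s ] IsSolution s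
  cut⇒solution (X , Y , cut , pm) = s , record
    { partner  = λ u → proj₁ (pm.perfect u)
    ; adjacent = λ u → proj₁ (proj₂ (pm.perfect u))
    ; opposite = λ u → crossing (proj₂ (proj₂ (pm.perfect u)))
    ; unique   = λ {u} {w} uw sw → pm.matching (uw , crosses sw) (proj₂ (pm.perfect u))
    }
    where
    module cut = IsCut cut
    module pm = IsPerfectMatching pm
    s : Fin n → Bool
    s u = does (u ∈? X)

    Y⇒∉X : ∀ {u} → u ∈ˢ Y → ¬ (u ∈ˢ X)
    Y⇒∉X u∈Y u∈X = ∉⊥ (subst (_ ∈ˢ_) cut.disjoint (x∈p∩q⁺ (u∈X , u∈Y)))

    ∉X⇒Y : ∀ {u} → ¬ (u ∈ˢ X) → u ∈ˢ Y
    ∉X⇒Y {u} u∉X with x∈p∪q⁻ X Y (subst (u ∈ˢ_) (sym cut.covers) ∈⊤)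
    ... | inj₁ u∈X = contradiction u∈X u∉X
    ... | inj₂ u∈Y = u∈Y

    crossing : ∀ {u w} → (u ∈ˢ X × w ∈ˢ Y) ⊎ (u ∈ˢ Y × w ∈ˢ X) → s w ≡ not (s u)
    crossing (inj₁ (u∈X , w∈Y)) = trans (dec-false (_ ∈? X) (Y⇒∉X w∈Y)) (cong not (sym (dec-true (_ ∈? X) u∈X)))
    crossing (inj₂ (u∈Y , w∈X)) = trans (dec-true (_ ∈? X) w∈X) (cong not (sym (dec-false (_ ∈? X) (Y⇒∉X u∈Y))))

    crosses : ∀ {u w} → s w ≡ not (s u) → (u ∈ˢ X × w ∈ˢ Y) ⊎ (u ∈ˢ Y × w ∈ˢ X)
    crosses {u} {w} eq with u ∈? X | w ∈? X
    ... | yes u∈X | no w∉X  = inj₁ (u∈X , ∉X⇒Y w∉X)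
    ... | no u∉X  | yes w∈X = inj₂ (∉X⇒Y u∉X , w∈X)
    crosses () | yes _ | yes _
    crosses () | no _  | no _

  -- The vertex `z` and its partner lie on different sides, so neither side is empty.
  solution⇒cut : Fin n → ∃[ s ] IsSolution s → HasPerfectMatchingCut G
  solution⇒cut z (s , sol) = side s , side (not ∘ s) , cut , record
    { symmetric = λ { (uv , inj₁ (u∈ , v∈)) → ~-sym uv , inj₂ (v∈ , u∈)
                    ; (uv , inj₂ (u∈ , v∈)) → ~-sym uv , inj₁ (v∈ , u∈) }
    ; edges     = proj₁
    ; matching  = λ (uv , v×) (uw , w×) → opposite-unique uw (crossing w×) uv (crossing v×)
    ; perfect   = λ u → partner u , adjacent u , crosses (opposite u)
    }
    where
    open IsSolution sol
    side : (Fin n → Bool) → Subset n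
    side f = Vec.tabulate f

    ∈-side⁺ : ∀ {f u} → f u ≡ true → u ∈ˢ side f
    ∈-side⁺ {f} {u} eq = lookup⇒[]= u (side f) (trans (lookup∘tabulate f u) eq)

    ∈-side⁻ : ∀ {f u} → u ∈ˢ side f → f u ≡ true
    ∈-side⁻ {f} {u} u∈ = trans (sym (lookup∘tabulate f u)) ([]=⇒lookup u∈)

    Cross : Fin n → Fin n → Set
    Cross u w = (u ∈ˢ side s × w ∈ˢ side (not ∘ s)) ⊎ (u ∈ˢ side (not ∘ s) × w ∈ˢ side s)

    not⁻ : ∀ {b} → not b ≡ true → b ≡ false
    not⁻ {false} _ = refl

    crossing : ∀ {u w} → Cross u w → s w ≡ not (s u)
    crossing (inj₁ (u∈ , w∈)) = trans (not⁻ (∈-side⁻ w∈)) (cong not (sym (∈-side⁻ u∈)))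
    crossing (inj₂ (u∈ , w∈)) = trans (∈-side⁻ w∈) (cong not (sym (not⁻ (∈-side⁻ u∈))))

    crosses : ∀ {u w} → s w ≡ not (s u) → Cross u w
    crosses {u} {w} sw with s u in su
    ... | true  = inj₁ (∈-side⁺ su , ∈-side⁺ (cong not sw))
    ... | false = inj₂ (∈-side⁺ (cong not su) , ∈-side⁺ sw)

    either : ∀ u → u ∈ˢ side s ⊎ u ∈ˢ side (not ∘ s)
    either u with s u in su
    ... | true  = inj₁ (∈-side⁺ su)
    ... | false = inj₂ (∈-side⁺ (cong not su))

    cut : IsCut (side s) (side (not ∘ s))
    cut = record
      { covers     = ⊆-antisym (λ _ → ∈⊤) (λ {u} _ → x∈p∪q⁺ (either u))
      ; disjoint   = Empty-unique λ (u , u∈) → let a , b = x∈p∩q⁻ (side s) (side (not ∘ s)) u∈ in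
          case trans (sym (∈-side⁻ a)) (not⁻ (∈-side⁻ b)) of λ ()
      ; X-nonempty = [ z ,_ , (λ z∈ → partner z , other z∈) ]′ (either z)
      ; Y-nonempty = [ (λ z∈ → partner z , other′ z∈) , z ,_ ]′ (either z)
      }
      where
      other : ∀ {u} → u ∈ˢ side (not ∘ s) → partner u ∈ˢ side s
      other {u} u∈ = ∈-side⁺ (trans (opposite u) (∈-side⁻ u∈))
      other′ : ∀ {u} → u ∈ˢ side s → partner u ∈ˢ side (not ∘ s)
      other′ {u} u∈ = ∈-side⁺ (cong not (trans (opposite u) (cong not (∈-side⁻ u∈))))

-- Polynomial bounds

-- The base `suc n` is positive, so powers grow with the exponent and degrees may simply be added;
-- it is also at most the size of the encoded graph.
record Polynomial (f : ℕ → ℕ) : Set where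
  constructor polynomial
  field
    coefficient degree : ℕ
    bounded            : ∀ n → f n ≤ coefficient * suc n ^ degree

module _ {f g : ℕ → ℕ} where

  poly-≤ : (∀ n → f n ≤ g n) → Polynomial g → Polynomial f
  poly-≤ f≤g (polynomial c k h) = polynomial c k λ n → ℕ.≤-trans (f≤g n) (h n)

  infixl 6 _⊕_
  infixl 7 _⊗_

  _⊕_ : Polynomial f → Polynomial g → Polynomial (λ n → f n + g n)
  polynomial c k h ⊕ polynomial d l h′ = polynomial (c + d) (k + l) λ n → begin
    f n + g n                                ≤⟨ ℕ.+-mono-≤ (h n) (h′ n) ⟩
    c * suc n ^ k + d * suc n ^ l            ≤⟨ ℕ.+-mono-≤
      (ℕ.*-monoʳ-≤ c (ℕ.^-monoʳ-≤ (suc n) (ℕ.m≤m+n k l)))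
      (ℕ.*-monoʳ-≤ d (ℕ.^-monoʳ-≤ (suc n) (ℕ.m≤n+m l k))) ⟩
    c * suc n ^ (k + l) + d * suc n ^ (k + l) ≡⟨ ℕ.*-distribʳ-+ _ c d ⟨
    (c + d) * suc n ^ (k + l)                ∎
    where open ℕ.≤-Reasoning

  _⊗_ : Polynomial f → Polynomial g → Polynomial (λ n → f n * g n)
  polynomial c k h ⊗ polynomial d l h′ = polynomial (c * d) (k + l) λ n → begin
    f n * g n                           ≤⟨ ℕ.*-mono-≤ (h n) (h′ n) ⟩
    c * suc n ^ k * (d * suc n ^ l)     ≡⟨ shuffle c (suc n ^ k) d (suc n ^ l) ⟩
    c * d * (suc n ^ k * suc n ^ l)     ≡⟨ cong (c * d *_) (ℕ.^-distribˡ-+-* (suc n) k l) ⟨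
    c * d * suc n ^ (k + l)             ∎
    where
    open ℕ.≤-Reasoning
    shuffle : ∀ a b c d → a * b * (c * d) ≡ a * c * (b * d)
    shuffle = solve-∀

const-poly : ∀ c → Polynomial (λ _ → c)
const-poly c = polynomial c 0 λ _ → ℕ.≤-reflexive (sym (ℕ.*-identityʳ c))

n-poly : Polynomial (λ n → n)
n-poly = polynomial 1 1 λ n → ℕ.≤-trans (ℕ.n≤1+n n)
  (ℕ.≤-reflexive (sym (trans (ℕ.*-identityˡ _) (ℕ.*-identityʳ _))))

linear : ∀ {cost : ℕ → ℕ} {a b : ℕ} →
  cost 0 ≤ a → (∀ m → cost (suc m) ≤ b + cost m) → ∀ m → cost m ≤ m * b + a
linear z s zero    = z
linear {a = a} {b} z s (suc m) = ℕ.≤-trans (s m)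
  (ℕ.≤-trans (ℕ.+-monoʳ-≤ b (linear z s m)) (ℕ.≤-reflexive (sym (ℕ.+-assoc b (m * b) a))))

find-poly : ∀ {b} → Polynomial b → Polynomial (λ n → find-cost n (b n))
find-poly {b} pb = poly-≤
  (λ n → linear {λ m → find-cost m (b n)} ℕ.≤-refl (λ m → ℕ.≤-reflexive (sym (ℕ.+-assoc 40 (b n) (find-cost m (b n))))) n)
  (n-poly ⊗ (const-poly 40 ⊕ pb) ⊕ const-poly 10)

neg-poly : ∀ {b} → Polynomial b → Polynomial (λ n → neg-cost (b n))
neg-poly = const-poly 25 ⊕_

and-poly : ∀ {a b} → Polynomial a → Polynomial b → Polynomial (λ n → and-cost (a n + b n))
and-poly pa pb = const-poly 40 ⊕ (pa ⊕ pb)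

ex-poly : ∀ {b} → Polynomial b → Polynomial (λ n → ex-cost n (b n))
ex-poly pb = const-poly 40 ⊕ find-poly pb

eval-poly : ∀ {k} (φ : Formula k) → Polynomial (eval-cost φ)
eval-poly {k} (edge _ _)  = const-poly 40 ⊕
  (const-poly (k * 7) ⊕ n-poly ⊗ const-poly 7 ⊕ const-poly (k * 7) ⊕ n-poly ⊗ const-poly 7)
eval-poly {k} (equal _ _) = const-poly 40 ⊕
  (const-poly (k * 7) ⊕ const-poly (k * 7) ⊕ n-poly ⊗ const-poly 2 ⊗ const-poly 15)
eval-poly {k} (col _ _)   = const-poly 40 ⊕
  (const-poly (k * 7) ⊕ n-poly ⊗ const-poly 7 ⊕ const-poly (5 * 15))
eval-poly (neg φ) = neg-poly (eval-poly φ)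
eval-poly (φ ∧ ψ) = and-poly (eval-poly φ) (eval-poly ψ)
eval-poly (φ ∨ ψ) = neg-poly (and-poly (neg-poly (eval-poly φ)) (neg-poly (eval-poly ψ)))
eval-poly (φ ⇒ ψ) = neg-poly (and-poly (eval-poly φ) (neg-poly (eval-poly ψ)))
eval-poly (ex φ)  = ex-poly (eval-poly φ)
eval-poly (all φ) = neg-poly (ex-poly (neg-poly (eval-poly φ)))

update-poly : ∀ r → Polynomial (rule-update-cost r)
update-poly r = poly-≤
  (λ n → linear {λ m → update-cost n m (toA n) (toB n)} {b = 85 + (n * 7 + (toA n + toB n))} ℕ.≤-refl (λ m → ℕ.≤-refl) n)
  (n-poly ⊗ (const-poly 85 ⊕ (n-poly ⊗ const-poly 7 ⊕ (eval-poly (to true) ⊕ eval-poly (to false)))) ⊕ const-poly 10)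
  where
  open Rule r
  toA = eval-cost (to true)
  toB = eval-cost (to false)

search-poly : ∀ r → Polynomial (λ n → search-cost r n n)
search-poly r = poly-≤
  (λ n → linear {search-cost r n} {b = 100 + (eval-cost (Rule.branch r) n + rule-update-cost r n)} ℕ.≤-refl (λ m → ℕ.≤-refl) n)
  (n-poly ⊗ (const-poly 100 ⊕ (eval-poly (Rule.branch r) ⊕ update-poly r)) ⊕ const-poly 10)

try-poly : ∀ φ rs → Polynomial (try-cost φ rs)
try-poly φ []       = const-poly 60 ⊕ (const-poly (size (code φ)) ⊕ eval-poly φ)
try-poly φ (r ∷ rs) = const-poly 60 ⊕ (find-poly (eval-poly (Rule.guard r)) ⊕ (search-poly r ⊕ try-poly φ rs))

solve-poly : ∀ φ rs → Polynomial (solve-cost φ rs)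
solve-poly φ rs = const-poly 60 ⊕ (const-poly (size (encodeList (map rule-code rs))) ⊕ try-poly φ rs)

-- Preparing the input and bounding the whole run

module _ (rules final : Tree) where
  open Program (program rules final)
  open Execution rules final

  index⁺ : ∀ m (f : Fin m → Tree) i → Run (encodeList (tabulate f) ∷ unary i ∷ []) (body index)
    (encodeList (tabulate {n = m} λ j → unary (toℕ j + i))) 0 (10 + m * 15)
  index⁺ zero    f i = pack 10 z≤n (case-nil⁺ (#⁺ 0) nil⁺)
  index⁺ (suc m) f i = subst
    (λ t → Run (encodeList (tabulate f) ∷ unary i ∷ []) (body index) (cons (unary i) (encodeList t)) 0 (10 + suc m * 15))
    (tabulate-cong λ j → cong unary (ℕ.+-suc (toℕ j) i))
    (pack 15 ℕ.≤-refl
      (case-cons⁺ (#⁺ 0) (cons⁺ (#⁺ 3) (call⁺ index (#⁺ 1 ∷⁺ [ cons⁺ nil⁺ (#⁺ 3) ]⁺) (index⁺ m (f ∘ suc) (suc i))))))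

  blank⁺ : ∀ m (f : Fin m → Tree) →
    Run (encodeList (tabulate f) ∷ []) (body blank) (encodeList (tabulate {n = m} λ _ → nil)) 0 (10 + m * 15)
  blank⁺ zero    f = pack 10 z≤n (case-nil⁺ (#⁺ 0) nil⁺)
  blank⁺ (suc m) f = pack 15 ℕ.≤-refl (case-cons⁺ (#⁺ 0) (cons⁺ nil⁺
    (call⁺ blank [ #⁺ 1 ]⁺ (blank⁺ m (f ∘ suc)))))

size-encodeList : ∀ ts → length ts < size (encodeList ts)
size-encodeList []       = s≤s z≤n
size-encodeList (t ∷ ts) = s≤s (ℕ.≤-trans (size-encodeList ts) (ℕ.m≤n+m _ (size t)))

size-encode : ∀ {n} (G : Graph n) → n < size (encode G)
size-encode {n} G = subst (_< size (encode G))
  (trans (length-map _ (allFin n)) (length-tabulate id)) (size-encodeList _)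

setup-cost : ℕ → ℕ
setup-cost n = 40 + (10 + n * 15 + (10 + n * 15))

total-cost : Formula 0 → List Rule → ℕ → ℕ
total-cost final rules n = setup-cost n + suc n * solve-cost final rules n

total-poly : ∀ final rules → Polynomial (total-cost final rules)
total-poly final rules =
  (const-poly 40 ⊕ (const-poly 10 ⊕ n-poly ⊗ const-poly 15 ⊕ (const-poly 10 ⊕ n-poly ⊗ const-poly 15))) ⊕
  (const-poly 1 ⊕ n-poly) ⊗ solve-poly final rules

module Main (P Q : ℕ) .{{_ : NonZero P}} (Q≤P : Q ≤ P)
  (rate₃₃ : 2 * Q ^ 3 ≤ P ^ 3) (rate₂₄ : Q ^ 2 * P ^ 2 + Q ^ 4 ≤ P ^ 4)
  (rate-many : ∀ d → d * Q ^ (2 + d) ≤ P ^ (2 + d))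
  (rules : List Rule) (final : Formula 0)
  (solve⁺ : ∀ {n} (G : Graph n) c → Engine.SolveRun P Q Q≤P rate₃₃ rate₂₄ rate-many rules final G c) where
  private
    R = encodeList (map rule-code rules)
    F = code final
    S = solve-cost final rules

  open Program (program R F) using (body; main)
  open Execution R F

  initial : ∀ {n} → Coloring n
  initial _ = nothing

  #unc-initial : ∀ {n} (G : Graph n) → Semantics.#unc G initial ≡ n
  #unc-initial {n} G = trans (cong length (filter-all (uncolored? initial) (All.universal (λ _ → refl) (allFin n))))
    (length-tabulate {n = n} id)
    where open Semantics G

  MainRun : ∀ {n} → Graph n → Set
  MainRun {n} G = ∃[ b ] ∃[ t ] (program R F on encode G Returns encodeBool b In t Steps)
    × Reflects (HasPerfectMatchingCut G) b × t * Q ^ n ≤ total-cost final rules n * P ^ n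

  module _ {n} (G : Graph n) (z : Fin n) where
    open Graph G
    open Semantics G
    open Eval R F G
    open Evaluation (program R F)
    private module E = Engine P Q Q≤P rate₃₃ rate₂₄ rate-many rules final G

    nonempty : ∃₂ λ s t → adjacency ≡ cons s t
    nonempty = at-vertex z (λ u → encodeList (tabulate λ v → encodeBool (adj u v)))
      where
      at-vertex : ∀ {m} → Fin m → (f : Fin m → Tree) → ∃₂ λ s t → encodeList (tabulate f) ≡ cons s t
      at-vertex {suc _} _ f = _ , _ , refl

    index-all⁺ : Run (adjacency ∷ nil ∷ []) (body index) (vertices (allFin n)) 0 (10 + n * 15)
    index-all⁺ = subst (λ t → Run (adjacency ∷ nil ∷ []) (body index) (encodeList t) 0 (10 + n * 15))
      (trans (tabulate-cong λ j → cong unary (ℕ.+-identityʳ (toℕ j))) (sym (map-tabulate id ⌜_⌝)))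
      (index⁺ R F n (λ u → encodeList (tabulate λ v → encodeBool (adj u v))) 0)

    blank-all⁺ : Run (adjacency ∷ []) (body blank) (coloring initial) 0 (10 + n * 15)
    blank-all⁺ = blank⁺ R F n (λ u → encodeList (tabulate λ v → encodeBool (adj u v)))

    finish : E.SolveRun initial → MainRun G
    finish (E.solved {steps = t} s time d) = conclude s d
      where
      bound : ∀ {t′} → t′ ≤ 40 + (10 + n * 15 + (10 + n * 15) + t) → t′ * Q ^ n ≤ total-cost final rules n * P ^ n
      bound {t′} t′≤ = begin
        t′ * Q ^ n                                      ≤⟨ ℕ.*-monoˡ-≤ (Q ^ n) t′≤ ⟩
        (setup-cost n + t) * Q ^ n                      ≡⟨ ℕ.*-distribʳ-+ (Q ^ n) (setup-cost n) t ⟩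
        setup-cost n * Q ^ n + t * Q ^ n                ≤⟨ ℕ.+-mono-≤ (ℕ.*-monoʳ-≤ (setup-cost n) (ℕ.^-monoˡ-≤ n Q≤P))
          (subst (λ m → t * Q ^ m ≤ suc m * (S n * P ^ m)) (#unc-initial G) time) ⟩
        setup-cost n * P ^ n + suc n * (S n * P ^ n)    ≡⟨ cong (setup-cost n * P ^ n +_) (ℕ.*-assoc (suc n) (S n) (P ^ n)) ⟨
        setup-cost n * P ^ n + suc n * S n * P ^ n      ≡⟨ ℕ.*-distribʳ-+ (P ^ n) (setup-cost n) (suc n * S n) ⟨
        total-cost final rules n * P ^ n                ∎
        where open ℕ.≤-Reasoning

      input⁺ : Run (adjacency ∷ []) (# 0) (cons (proj₁ nonempty) (proj₁ (proj₂ nonempty))) 1 0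
      input⁺ = subst (λ v → Run (adjacency ∷ []) (# 0) v 1 0) (proj₂ (proj₂ nonempty)) (#⁺ 0)

      answer : ∀ b → Reflects (HasPerfectMatchingCut G) b →
        Run (adjacency ∷ []) main (encodeBool b) 0 (40 + (10 + n * 15 + (10 + n * 15) + t)) → MainRun G
      answer b h (run {t′} m m≤) = b , t′ ,
        subst (λ x → program R F on x Returns encodeBool b In t′ Steps) (sym (encode-adjacency G {R} {F})) m , h , bound m≤

      solve-call : ∀ {s₁ s₂ v} → context initial ⊢ body solve ⇓ v ∣ t →
        Run (s₁ ∷ s₂ ∷ adjacency ∷ []) (call solve (# 2 ∷ call index (# 2 ∷ nil ∷ []) ∷ call blank (# 2 ∷ []) ∷ [])) v
          12 (10 + n * 15 + (10 + n * 15) + t)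
      solve-call s = call⁺ solve
        (#⁺ 2 ∷⁺ call⁺ index (#⁺ 2 ∷⁺ [ nil⁺ ]⁺) index-all⁺ ∷⁺ [ call⁺ blank [ #⁺ 2 ]⁺ blank-all⁺ ]⁺)
        (run {k = 5} {t} s (ℕ.m≤n+m t 5))

      conclude : ∀ {v} → context initial ⊢ body solve ⇓ v ∣ t → Verdict (Solvable initial) v → MainRun G
      conclude s (accepts (f , sol , _)) = answer true (ofʸ (solution⇒cut G z (f , sol)))
        (pack 40 (ℕ.≤-reflexive (ℕ.+-identityʳ _)) (case-cons⁺ input⁺ (case-cons⁺ (solve-call s) truth⁺)))
      conclude s (rejects ¬sv) = answer false
        (ofⁿ (λ pmc → let f , sol = cut⇒solution G pmc in ¬sv (f , sol , λ ())))
        (pack 40 (ℕ.≤-reflexive (ℕ.+-identityʳ _)) (case-cons⁺ input⁺ (case-nil⁺ (solve-call s) nil⁺)))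

  main⁺ : ∀ {n} (G : Graph n) → MainRun G
  main⁺ {zero} G = false , _ , case-nil (var _) nil , ofⁿ no-cut ,
    -- The three steps are the case distinction, the variable and `nil`; both powers with exponent 0
    -- equal 1.
    ℕ.*-monoˡ-≤ 1 {3} {total-cost final rules 0} (s≤s (s≤s (s≤s z≤n)))
    where
    open Evaluation (program R F)
    no-cut : ¬ HasPerfectMatchingCut G
    no-cut (_ , _ , cut , _) with () , _ ← IsCut.X-nonempty cut
  main⁺ {suc _} G = finish G zero (solve⁺ G initial)

-- Numerical inequalities for the rate

-- From d = 4 on, replacing d by d + 1 raises the factor d by at most 5/4, which is below `P / Q`.
-- Starting at d = 3 the ratio 4/3 would exceed 1.2721, so smaller d are checked separately.
power-beats-linear : ∀ {P Q} → Q ≤ P → 5 * Q ≤ 4 * P → 4 * Q ^ 6 ≤ P ^ 6 →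
  ∀ e → (4 + e) * Q ^ (6 + e) ≤ P ^ (6 + e)
power-beats-linear Q≤P step base zero = base
power-beats-linear {P} {Q} Q≤P step base (suc e) = begin
  (5 + e) * (Q * Q ^ (6 + e))  ≡⟨ left Q e (Q ^ (6 + e)) ⟩
  (5 * Q + e * Q) * Q ^ (6 + e) ≤⟨ ℕ.*-monoˡ-≤ (Q ^ (6 + e)) (ℕ.+-mono-≤ step (ℕ.*-monoʳ-≤ e Q≤P)) ⟩
  (4 * P + e * P) * Q ^ (6 + e) ≡⟨ right P e (Q ^ (6 + e)) ⟩
  P * ((4 + e) * Q ^ (6 + e))  ≤⟨ ℕ.*-monoʳ-≤ P (power-beats-linear Q≤P step base e) ⟩
  P * P ^ (6 + e)              ∎
  where
  open ℕ.≤-Reasoning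
  left : ∀ Q e x → (5 + e) * (Q * x) ≡ (5 * Q + e * Q) * x
  left = solve-∀
  right : ∀ P e x → (4 * P + e * P) * x ≡ P * ((4 + e) * x)
  right = solve-∀

compute-≤ : ∀ {m n} → T (m ≤ᵇ n) → m ≤ n
compute-≤ {m} {n} = ℕ.≤ᵇ⇒≤ m n

linear-below-power : ∀ {P Q} → Q ≤ P → 5 * Q ≤ 4 * P →
  1 * Q ^ 3 ≤ P ^ 3 → 2 * Q ^ 4 ≤ P ^ 4 → 3 * Q ^ 5 ≤ P ^ 5 → 4 * Q ^ 6 ≤ P ^ 6 →
  ∀ d → d * Q ^ (2 + d) ≤ P ^ (2 + d)
linear-below-power Q≤P step h₁ h₂ h₃ h₄ 0 = z≤n
linear-below-power Q≤P step h₁ h₂ h₃ h₄ 1 = h₁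
linear-below-power Q≤P step h₁ h₂ h₃ h₄ 2 = h₂
linear-below-power Q≤P step h₁ h₂ h₃ h₄ 3 = h₃
linear-below-power Q≤P step h₁ h₂ h₃ h₄ (suc (suc (suc (suc e)))) = power-beats-linear Q≤P step h₄ e

module _ (P Q : ℕ) .{{_ : NonZero P}} .{{_ : NonZero Q}} (Q≤P : Q ≤ P)
  (rate₃₃ : 2 * Q ^ 3 ≤ P ^ 3) (rate₂₄ : Q ^ 2 * P ^ 2 + Q ^ 4 ≤ P ^ 4)
  (rate-many : ∀ d → d * Q ^ (2 + d) ≤ P ^ (2 + d)) where

  module _ (rules : List Rule) (final : Formula 0)
    (solve⁺ : ∀ {n} (G : Graph n) c → Engine.SolveRun P Q Q≤P rate₃₃ rate₂₄ rate-many rules final G c) where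

    decides : program (encodeList (map rule-code rules)) (code final)
      Decides HasPerfectMatchingCut InTimeO*⟨ P / Q ⟩ⁿ
    decides = coefficient , degree , λ {n} G →
      let b , t , returns , correct , time = Main.main⁺ P Q Q≤P rate₃₃ rate₂₄ rate-many rules final solve⁺ G
      in b , t , returns , correct , ℕ.≤-trans time
        (ℕ.*-monoˡ-≤ (P ^ n) (ℕ.≤-trans (bounded n)
          (ℕ.*-monoʳ-≤ coefficient (ℕ.^-monoˡ-≤ degree (size-encode G)))))
      where
      open Polynomial (total-poly final rules)

  algorithm-decides : algorithm Decides HasPerfectMatchingCut InTimeO*⟨ P / Q ⟩ⁿ
  algorithm-decides = decides rules perfect (solve⁺ P Q Q≤P rate₃₃ rate₂₄ rate-many)

theorem4 : ∃[ A ] (A Decides HasPerfectMatchingCut InTimeO*⟨ 12721 / 10000 ⟩ⁿ)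
theorem4 = algorithm ,
  -- The tight inequality is the one for (2,4), whose root is about 1.27202. The vector for d = 4
  -- has rate 4^(1/6) = 2^(1/3), about 1.26, the same as (3,3).
  algorithm-decides 12721 10000 (compute-≤ _) (compute-≤ _) (compute-≤ _)
    (linear-below-power (compute-≤ _) (compute-≤ _) (compute-≤ _) (compute-≤ _) (compute-≤ _) (compute-≤ _))
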